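{- Let $\Gamma$ be a distance-regular graph with classical parameters $(D,b,\alpha,\beta)$ such that $b\ge2$, $b-1\ge\alpha\ge1$ and $D\ge3$, geometric with respect to a set $\mathcal C$ of Delsarte cliques (members of $\mathcal C$ are called lines). Let $r=[D]$. Assume that for every vertex $x$ the local graph at $x$ is the $\alpha$-clique extension of a $\frac{\beta}{\alpha}\times r$-grid, and assume $\beta>\alpha r$. Let $M$ be an assembly and $x$ a vertex at distance 2 from $M$. Let $B=\Gamma_2(x)\cap M$ and $L(B)=\{\ell\cap B : \ell\in\mathcal C,\ |\ell\cap B|\ge 2\}$. Then $(B,L(B))$ is a $2$-$(\alpha(b+1)+1,\alpha+1,1)$-design. In particular $\alpha+1$ divides $b(b+1)$.
   Context: Distance-regular graph with intersection numbers $b_i,c_i$, valency $k=b_0$; $\Gamma_i(x)$ is the set of vertices at distance $i$ from $x$. For integer $b\ne1$, $[j]=\frac{b^j-1}{b-1}$. Classical parameters $(D,b,\alpha,\beta)$: diameter $D$, $b_i=([D]-[i])(\beta-\alpha[i])$, $c_i=[i](1+\alpha[i-1])$. A Delsarte clique is a clique with $1+\frac{k}{ -\theta_{\min}}$ vertices, $\theta_{\min}$ the smallest adjacency eigenvalue; geometric with respect to $\mathcal C$ means every edge lies in exactly one member of $\mathcal C$. An assembly is a maximal clique of $\Gamma$ not in $\mathcal C$. $d(x,M)=\min_{y\in M}d(x,y)$. The $m\times n$-grid is $K_m\Box K_n$; the $s$-clique extension of $\Delta$ replaces each vertex by an $s$-clique, vertices in distinct cliques adjacent iff the original vertices are adjacent.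 A $t$-$(v,k,\lambda)$-design is a pair $(\mathcal P,\mathcal B)$ with $|\mathcal P|=v$, $\mathcal B$ a set of $k$-subsets of $\mathcal P$, such that every $t$-subset of $\mathcal P$ lies in exactly $\lambda$ members of $\mathcal B$. -}

module Defs where

open import Level using (0ℓ)
open import Data.Bool using (if_then_else_)
open import Data.Nat as ℕ using (ℕ; zero; suc)
open import Data.Nat.Properties using (allUpTo?)
open import Data.Integer as ℤ using (ℤ; +_; 1ℤ)
open import Data.Rational as ℚ using (ℚ; 0ℚ; 1ℚ)
open import Data.Rational.Properties using (+-0-commutativeMonoid)
open import Data.Fin using (Fin; _≟_)
open import Data.Fin.Properties using (any?)
open import Data.Fin.Subset using (Subset; _∈_; _⊆_; _∩_; ∣_∣)
open import Data.Vec using (tabulate)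
open import Data.List using (List; length)
open import Data.List.Membership.Propositional using () renaming (_∈_ to _∈ˡ_)
open import Data.List.Relation.Unary.Unique.Propositional using (Unique)
open import Data.Product using (∃; ∃!; Σ-syntax; ∃-syntax; _×_; _,_; proj₁)
open import Data.Sum using (_⊎_; inj₁; inj₂)
open import Function using (_∘_)
open import Function.Bundles using (_↔_; _⇔_; Inverse)
open import Relation.Binary using (Rel)
open import Relation.Binary.PropositionalEquality
  using (_≡_; _≢_; refl; sym; ≢-sym)
open import Relation.Nullary using (¬_; Dec; does; ¬?; _×-dec_)
open import Relation.Unary using (Pred; Decidable)
import Algebra.Properties.CommutativeMonoid.Sum +-0-commutativeMonoid as ℚSum

record Graph (V : Set) : Set₁ where
  field
    _~_    : Rel V 0ℓ
    ~-sym  : ∀ {u v} → u ~ v → v ~ u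
    irrefl : ∀ {v} → ¬ (v ~ v)

_≅_ : {V W : Set} → Graph V → Graph W → Set
_≅_ {V} {W} G H =
  Σ[ f ∈ V ↔ W ] (∀ u v → Graph._~_ G u v ⇔ Graph._~_ H (Inverse.to f u) (Inverse.to f v))

K : ∀ n → Graph (Fin n)
K n = record { _~_ = _≢_ ; ~-sym = ≢-sym ; irrefl = λ v≢v → v≢v refl }

_□_ : {V W : Set} → Graph V → Graph W → Graph (V × W)
G □ H = record
  { _~_    = λ { (u , v) (u′ , v′) → (u ≡ u′ × v H.~ v′) ⊎ (u G.~ u′ × v ≡ v′) }
  ; ~-sym  = λ { (inj₁ (p , q)) → inj₁ (sym p , H.~-sym q)
               ; (inj₂ (p , q)) → inj₂ (G.~-sym p , sym q) }
  ; irrefl = λ { (inj₁ (_ , q)) → H.irrefl q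
               ; (inj₂ (p , _)) → G.irrefl p }
  }
  where
  module G = Graph G
  module H = Graph H

grid : ∀ m n → Graph (Fin m × Fin n)
grid m n = K m □ K n

cliqueExtension : {V : Set} (s : ℕ) → Graph V → Graph (V × Fin s)
cliqueExtension s G = record
  { _~_    = λ { (u , i) (v , j) → (u ≡ v × i ≢ j) ⊎ (u G.~ v) }
  ; ~-sym  = λ { (inj₁ (p , q)) → inj₁ (sym p , ≢-sym q)
               ; (inj₂ q) → inj₂ (G.~-sym q) }
  ; irrefl = λ { (inj₁ (_ , i≢i)) → i≢i refl
               ; (inj₂ q) → G.irrefl q }
  }
  where module G = Graph G

record FiniteGraph (n : ℕ) : Set₁ where
  field
    graph : Graph (Fin n)
  open Graph graph public
  field
    _~?_ : ∀ u v → Dec (u ~ v)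

fromDec : ∀ {n} {P : Pred (Fin n) 0ℓ} → Decidable P → Subset n
fromDec P? = tabulate (does ∘ P?)

module _ {n : ℕ} (Γ : FiniteGraph n) where
  open FiniteGraph Γ

  Walk : ℕ → Fin n → Fin n → Set
  Walk zero    x y = x ≡ y
  Walk (suc i) x y = ∃[ z ] (x ~ z × Walk i z y)

  walk? : ∀ i x y → Dec (Walk i x y)
  walk? zero    x y = x ≟ y
  walk? (suc i) x y = any? (λ z → (x ~? z) ×-dec walk? i z y)

  Dist : Fin n → Fin n → ℕ → Set
  Dist x y i = Walk i x y × (∀ {j} → j ℕ.< i → ¬ Walk j x y)

  dist? : ∀ x y i → Dec (Dist x y i)
  dist? x y i = walk? i x y ×-dec allUpTo? (λ j → ¬? (walk? j x y)) i

  sphere : ℕ → Fin n → Subset n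
  sphere i x = fromDec (λ y → dist? x y i)

  DistToSet : Fin n → Subset n → ℕ → Set
  DistToSet x M i =
    (∃[ y ] (y ∈ M × Dist x y i)) × (∀ y j → y ∈ M → Dist x y j → i ℕ.≤ j)

  Diameter : ℕ → Set
  Diameter D =
    (∀ x y → ∃[ i ] (i ℕ.≤ D × Dist x y i)) × (∃[ x ] ∃[ y ] Dist x y D)

  induced : (S : Subset n) → Graph (∃ (_∈ S))
  induced S = record
    { _~_    = λ u v → proj₁ u ~ proj₁ v
    ; ~-sym  = ~-sym
    ; irrefl = irrefl
    }

  localGraph : (x : Fin n) → Graph (∃ (_∈ sphere 1 x))
  localGraph x = induced (sphere 1 x)

  -- Only the values b i with i ≤ diameter and c i with 1 ≤ i ≤ diameter
  -- are determined by the graph; the other values are junk.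
  record DistanceRegular : Set where
    field
      connected : ∀ x y → ∃[ i ] Walk i x y
      b c       : ℕ → ℕ
      b-count   : ∀ i x y → Dist x y i →
                  ∣ sphere (suc i) x ∩ sphere 1 y ∣ ≡ b i
      c-count   : ∀ i x y → Dist x y (suc i) →
                  ∣ sphere i x ∩ sphere 1 y ∣ ≡ c (suc i)

    valency : ℕ
    valency = b 0

fromℤ : ℤ → ℚ
fromℤ i = i ℚ./ 1

fromℕ : ℕ → ℚ
fromℕ m = fromℤ (+ m)

-- The instance argument says b ≠ 1.  The division is exact.
bracket : (b : ℤ) .{{_ : ℤ.NonZero (b ℤ.- 1ℤ)}} → ℕ → ℤ
bracket b j = (b ℤ.^ j ℤ.- 1ℤ) ℤ./ (b ℤ.- 1ℤ)

record ClassicalParameters {n : ℕ} {Γ : FiniteGraph n} (dr : DistanceRegular Γ)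
         (D : ℕ) (b : ℤ) .{{_ : ℤ.NonZero (b ℤ.- 1ℤ)}} (α β : ℚ) : Set where
  private
    module dr = DistanceRegular dr

    [_] : ℕ → ℚ
    [ j ] = fromℤ (bracket b j)
  field
    diameter : Diameter Γ D
    b-eq     : ∀ i → i ℕ.≤ D →
               fromℕ (dr.b i) ≡ ([ D ] ℚ.- [ i ]) ℚ.* (β ℚ.- α ℚ.* [ i ])
    -- c₀ = 0 by convention, so the formula only has content for i + 1 ≥ 1.
    c-eq     : ∀ i → i ℕ.< D →
               fromℕ (dr.c (suc i)) ≡ [ suc i ] ℚ.* (1ℚ ℚ.+ α ℚ.* [ i ])

-- Real numbers as Cauchy sequences of rationals, compared by _≃_ below.

record ℝ : Set where
  field
    seq    : ℕ → ℚ
    cauchy : ∀ ε → 0ℚ ℚ.< ε → ∃[ N ] (∀ p q → N ℕ.≤ p → N ℕ.≤ q →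
             ℚ.∣ seq p ℚ.- seq q ∣ ℚ.< ε)
open ℝ public

-- Sums and products of Cauchy sequences are formed termwise and are again
-- Cauchy, so polynomial equations between reals are stated as ≃ between
-- termwise sequences.
_≃_ : Rel (ℕ → ℚ) 0ℓ
f ≃ g = ∀ ε → 0ℚ ℚ.< ε → ∃[ N ] (∀ p → N ℕ.≤ p → ℚ.∣ f p ℚ.- g p ∣ ℚ.< ε)

_≤ᴿ_ : Rel ℝ 0ℓ
x ≤ᴿ y = ∀ ε → 0ℚ ℚ.< ε → ∃[ N ] (∀ p → N ℕ.≤ p → seq x p ℚ.< seq y p ℚ.+ ε)

-- Being nonzero, in the constructive sense of apartness from 0.
_#0 : ℝ → Set
x #0 = ∃[ ε ] (0ℚ ℚ.< ε × ∃[ N ] (∀ p → N ℕ.≤ p → ε ℚ.< ℚ.∣ seq x p ∣))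

module _ {n : ℕ} (Γ : FiniteGraph n) where
  open FiniteGraph Γ

  adjacency : Fin n → Fin n → ℚ
  adjacency x y = if does (x ~? y) then 1ℚ else 0ℚ

  Eigenvalue : ℝ → Set
  Eigenvalue θ = Σ[ v ∈ (Fin n → ℝ) ]
    (∃[ x ] (v x #0)) ×
    (∀ x → (λ p → ℚSum.sum (λ y → adjacency x y ℚ.* seq (v y) p))
           ≃ (λ p → seq θ p ℚ.* seq (v x) p))

  SmallestEigenvalue : ℝ → Set
  SmallestEigenvalue θ = Eigenvalue θ × (∀ η → Eigenvalue η → θ ≤ᴿ η)

  Clique : Subset n → Set
  Clique C = ∀ {x y} → x ∈ C → y ∈ C → x ≢ y → x ~ y

  MaximalClique : Subset n → Set
  MaximalClique C = Clique C × (∀ C′ → Clique C′ → C ⊆ C′ → C′ ≡ C)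

  -- ∣C∣ = 1 + k / (- θmin), with the denominator cleared; when k > 0 the
  -- equation forces θmin ≠ 0.
  DelsarteClique : DistanceRegular Γ → Subset n → Set
  DelsarteClique dr C = Clique C × Σ[ θ ∈ ℝ ] (SmallestEigenvalue θ ×
    (λ p → (fromℕ ∣ C ∣ ℚ.- 1ℚ) ℚ.* (ℚ.- seq θ p))
      ≃ (λ _ → fromℕ (DistanceRegular.valency dr)))

  Geometric : DistanceRegular Γ → Pred (Subset n) 0ℓ → Set
  Geometric dr 𝒞 =
    (∀ C → 𝒞 C → DelsarteClique dr C) ×
    (∀ x y → x ~ y → ∃! _≡_ (λ C → 𝒞 C × x ∈ C × y ∈ C))

  Assembly : Pred (Subset n) 0ℓ → Subset n → Set
  Assembly 𝒞 M = MaximalClique M × ¬ 𝒞 M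

Exactly : {A : Set} → ℕ → Pred A 0ℓ → Set
Exactly {A} m P = Σ[ xs ∈ List A ]
  (Unique xs × length xs ≡ m × (∀ a → a ∈ˡ xs ⇔ P a))

record IsDesign {n : ℕ} (t v k l : ℕ)
         (𝒫 : Subset n) (ℬ : Pred (Subset n) 0ℓ) : Set where
  field
    points  : ∣ 𝒫 ∣ ≡ v
    blocks  : ∀ S → ℬ S → S ⊆ 𝒫 × ∣ S ∣ ≡ k
    balance : ∀ T → T ⊆ 𝒫 → ∣ T ∣ ≡ t → Exactly l (λ S → ℬ S × T ⊆ S)

traces : {n : ℕ} → Pred (Subset n) 0ℓ → Subset n → Pred (Subset n) 0ℓ
traces 𝒞 B S = ∃[ ℓ ] (𝒞 ℓ × 2 ℕ.≤ ∣ ℓ ∩ B ∣ × S ≡ ℓ ∩ B)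

{-# OPTIONS --safe #-}
module Submission where

-- The local grids decompose Γ into cliques of size β + 1 (a vertex and a column of its
-- local grid), with r = [D] of them through each vertex and every edge in exactly one.
-- Writing N for their incidence matrix, A + rI = N Nᵀ is positive semidefinite, so the
-- smallest eigenvalue is at least -r, and a Delsarte clique that contains an edge has at
-- least β + 1 points.  As β > αr, the lines are exactly these cliques, and an assembly
-- consists of a vertex and a row of its local grid.
--
-- Let d(x, y) = 2 and look at the local grid at y.  Each row and each column that contains
-- a common neighbour of x and y contains exactly α + 1 of them, so by the value of c₂
-- there are b + 1 such rows and b + 1 such columns.  All points on them are at distance
-- at most 2 from x, and by the value of b₂ all the remaining points are at distance 3.
-- If y lies in M and d(x, M) = 2, the row of M contains no common neighbour, so its points
-- in Γ₂(x) are those in the b + 1 columns.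

open import Defs
open import Level using (0ℓ)
open import Algebra.Bundles using (module CommutativeRing)
open import Data.Bool using (true; false; if_then_else_)
open import Data.Bool.Properties using () renaming (_≟_ to _≟ᵇ_)
open import Data.Empty using (⊥)
open import Data.Fin using (Fin; zero; suc; _≟_; combine; remQuot; punchIn; punchOut)
import Data.Fin.Properties as Fin
open import Data.Fin.Properties using (any?)
open import Data.Fin.Subset using (Subset; inside; outside; _∈_; _∉_; _⊆_; _∩_; _∪_; ∁; ⁅_⁆; ∣_∣)
  renaming (⊥ to ∅)
open import Data.Fin.Subset.Properties
open import Data.Integer as ℤ using (ℤ; 1ℤ; +_)
open import Data.Integer.DivMod using (div-pos-is-/ℕ)
import Data.Integer.Properties as ℤ
open import Data.List using ([]; _∷_)
open import Data.List.Membership.Propositional using () renaming (_∈_ to _∈ˡ_)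
import Data.List.Relation.Unary.All as All
import Data.List.Relation.Unary.AllPairs as AllPairs
open import Data.List.Relation.Unary.Any using (here)
open import Data.Nat as ℕ using (ℕ; zero; suc; _+_; _*_; _∸_; _≤_; _<_; s≤s; z≤n)
open import Data.Nat.Divisibility using (_∣_; n∣m*n; *-cancelʳ-∣; ∣m+n∣m⇒∣n; divides)
import Data.Nat.DivMod as ℕ
import Data.Nat.Properties as ℕ
open import Data.Nat.Solver using (module +-*-Solver)
open import Data.Product using (∃; ∃₂; ∃-syntax; _×_; _,_; proj₁; proj₂; uncurry)
open import Data.Product.Function.NonDependent.Propositional using (_×-↔_)
open import Data.Rational as ℚ using (ℚ; 0ℚ; 1ℚ; ½; toℚᵘ)
import Data.Rational.Properties as ℚ
import Data.Rational.Solver as ℚS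
open import Data.Rational.Unnormalised as ℚᵘ using (mkℚᵘ; *≡*; *≤*)
import Data.Rational.Unnormalised.Properties as ℚᵘ
open import Data.Sum as Sum using (_⊎_; inj₁; inj₂)
open import Data.Sum.Function.Propositional using (_⊎-↔_)
open import Data.Vec using ([]; _∷_; here; there; lookup)
open import Data.Vec.Properties using (≡-dec; []=⇒lookup; lookup⇒[]=; lookup∘tabulate)
open import Data.Vec.Properties.WithK using ([]=-irrelevant)
open import Function using (_∘_)
open import Function.Bundles using (_↔_; Inverse; Equivalence; mk⇔)
open import Function.Properties.Inverse using (↔-refl; ↔-trans)
open import Relation.Binary using (DecidableEquality)
open import Relation.Binary.PropositionalEquality hiding ([_])
open import Relation.Nullary using (¬_; Dec; yes; no; does; contradiction; ¬?; _×-dec_; _⊎-dec_)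
open import Relation.Nullary.Decidable using (dec-true; dec-false; decidable-stable)
open import Relation.Unary using (Pred; Decidable)
open import Algebra.Properties.Semiring.Sum (CommutativeRing.semiring ℚ.+-*-commutativeRing)
  using (sum; sum-cong-≗; sum-replicate-zero; ∑-comm; ∑-distrib-+; *-distribˡ-sum; *-distribʳ-sum)

-- Cardinalities of subsets

∈-fromDec⁺ : ∀ {n} {P : Pred (Fin n) 0ℓ} (P? : Decidable P) {x} → P x → x ∈ fromDec P?
∈-fromDec⁺ P? {x} px = lookup⇒[]= x _ (trans (lookup∘tabulate (does ∘ P?) x) (dec-true (P? x) px))

∈-fromDec⁻ : ∀ {n} {P : Pred (Fin n) 0ℓ} (P? : Decidable P) {x} → x ∈ fromDec P? → P x
∈-fromDec⁻ P? {x} x∈ with P? x | trans (sym (lookup∘tabulate (does ∘ P?) x)) ([]=⇒lookup x∈)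
... | yes px | _ = px

-- The length `m` is independent of `∣ p ∣`, so that an enumeration can be transported along an
-- equation for the size.
record Enumerates {n m} (p : Subset n) (e : Fin m → Fin n) : Set where
  field
    injective : ∀ {s t} → e s ≡ e t → s ≡ t
    sound     : ∀ t → e t ∈ p
    complete  : ∀ {x} → x ∈ p → ∃[ t ] e t ≡ x
open Enumerates

enumerate : ∀ {n} (p : Subset n) → ∃[ e ] Enumerates {m = ∣ p ∣} p e
enumerate [] = (λ ()) , record { injective = λ { {()} } ; sound = λ () ; complete = λ { {()} } }
enumerate (outside ∷ p) with enumerate p
... | e , E = suc ∘ e , record
  { injective = injective E ∘ Fin.suc-injective
  ; sound     = there ∘ sound E
  ; complete  = λ { (there x∈p) → let t , eq = complete E x∈p in t , cong suc eq } }
enumerate {suc n} (inside ∷ p) with enumerate p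
... | e , E = e′ , record { injective = inj ; sound = snd ; complete = cmp }
  where
  e′ : Fin (suc ∣ p ∣) → Fin (suc n)
  e′ zero    = zero
  e′ (suc t) = suc (e t)
  inj : ∀ {s t} → e′ s ≡ e′ t → s ≡ t
  inj {zero}  {zero}  _  = refl
  inj {suc s} {suc t} eq = cong suc (injective E (Fin.suc-injective eq))
  snd : ∀ t → e′ t ∈ inside ∷ p
  snd zero    = here
  snd (suc t) = there (sound E t)
  cmp : ∀ {x} → x ∈ inside ∷ p → ∃[ t ] e′ t ≡ x
  cmp here        = zero , refl
  cmp (there x∈p) = let t , eq = complete E x∈p in suc t , cong suc eq

-- Choosing one index for each element of `p` is injective, because `e` recovers the element from
-- its index. The index type `I` allows counting by products and sums directly.
∣p∣≤-cover : ∀ {n m} {I : Set} (p : Subset n) (φ : Fin m ↔ I) (e : I → Fin n) →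
             (∀ {x} → x ∈ p → ∃[ i ] e i ≡ x) → ∣ p ∣ ≤ m
∣p∣≤-cover p φ e cover = Fin.injective⇒≤ {f = f} inj
  where
  open Inverse φ
  E = proj₂ (enumerate p)
  index = λ t → cover (sound E t)
  f = λ t → from (proj₁ (index t))
  inj : ∀ {s t} → f s ≡ f t → s ≡ t
  inj {s} {t} eq = injective E (begin
    proj₁ (enumerate p) s  ≡⟨ proj₂ (index s) ⟨
    e (proj₁ (index s))    ≡⟨ cong e (strictlyInverseˡ _) ⟨
    e (to (f s))           ≡⟨ cong (e ∘ to) eq ⟩
    e (to (f t))           ≡⟨ cong e (strictlyInverseˡ _) ⟩
    e (proj₁ (index t))    ≡⟨ proj₂ (index t) ⟩
    proj₁ (enumerate p) t  ∎)
    where open ≡-Reasoning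

≤∣p∣-embed : ∀ {n m} {I : Set} (p : Subset n) (φ : Fin m ↔ I) (e : I → Fin n) →
             (∀ {i i′} → e i ≡ e i′ → i ≡ i′) → (∀ i → e i ∈ p) → m ≤ ∣ p ∣
≤∣p∣-embed p φ e e-inj e∈p = Fin.injective⇒≤ {f = f} inj
  where
  open Inverse φ
  E = proj₂ (enumerate p)
  index = λ t → complete E (e∈p (to t))
  f = λ t → proj₁ (index t)
  inj : ∀ {s t} → f s ≡ f t → s ≡ t
  inj {s} {t} eq = to-inj (e-inj (trans (sym (proj₂ (index s)))
                     (trans (cong (proj₁ (enumerate p)) eq) (proj₂ (index t)))))
    where
    to-inj : ∀ {s t} → to s ≡ to t → s ≡ t
    to-inj {s} {t} q = trans (sym (strictlyInverseʳ s)) (trans (cong from q) (strictlyInverseʳ t))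

∣p∣≡-by : ∀ {n m} {I : Set} (p : Subset n) (φ : Fin m ↔ I) (e : I → Fin n) →
          (∀ {i i′} → e i ≡ e i′ → i ≡ i′) → (∀ i → e i ∈ p) →
          (∀ {x} → x ∈ p → ∃[ i ] e i ≡ x) → ∣ p ∣ ≡ m
∣p∣≡-by p φ e inj e∈p cover = ℕ.≤-antisym (∣p∣≤-cover p φ e cover) (≤∣p∣-embed p φ e inj e∈p)

⊆∧∣∣≤⇒≡ : ∀ {n} {p q : Subset n} → p ⊆ q → ∣ q ∣ ≤ ∣ p ∣ → p ≡ q
⊆∧∣∣≤⇒≡ {p = p} {q} p⊆q q≤p = ⊆-antisym p⊆q λ {x} x∈q →
  decidable-stable (x ∈? p) λ x∉p →
  ℕ.<⇒≱ (p⊂q⇒∣p∣<∣q∣ (p⊆q , x , x∈q , x∉p)) q≤p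

module _ {n m} (p : Subset n) (F : Fin m → Subset n) where

  support : Subset m
  support = fromDec (λ d → nonempty? (p ∩ F d))

  -- Disjointness is asked for only inside `p`: the rows and columns to which this is applied all
  -- share the centre of the local grid.
  ∣p∣-fibres : ∀ k →
    (∀ {x} → x ∈ p → ∃[ d ] x ∈ F d) →
    (∀ {x d d′} → x ∈ p → x ∈ F d → x ∈ F d′ → d ≡ d′) →
    (∀ {x d} → x ∈ p → x ∈ F d → ∣ p ∩ F d ∣ ≡ k) →
    ∣ p ∣ ≡ ∣ support ∣ * k
  ∣p∣-fibres k cover disjoint size =
    ∣p∣≡-by p Fin.*↔× (uncurry e) inj (λ (t , s) → proj₁ (e∈ t s)) cmp
    where
    S = enumerate support
    col = proj₁ S
    -- Only nonempty parts have a known size; membership in `support` supplies the point that `size`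
    -- asks for.
    fibre : ∀ d → d ∈ support → ∃[ e ] Enumerates {m = k} (p ∩ F d) e
    fibre d d∈ = let x , x∈ = ∈-fromDec⁻ (λ d → nonempty? (p ∩ F d)) d∈
                     x∈p , x∈F = x∈p∩q⁻ p (F d) x∈
                 in subst (λ m → ∃[ e ] Enumerates {m = m} (p ∩ F d) e) (size x∈p x∈F) (enumerate (p ∩ F d))
    f : ∀ t → ∃[ e ] Enumerates {m = k} (p ∩ F (col t)) e
    f t = fibre (col t) (sound (proj₂ S) t)
    e : Fin ∣ support ∣ → Fin k → Fin n
    e t s = proj₁ (f t) s
    e∈ : ∀ t s → e t s ∈ p × e t s ∈ F (col t)
    e∈ t s = x∈p∩q⁻ p (F (col t)) (sound (proj₂ (f t)) s)
    inj : ∀ {i i′} → uncurry e i ≡ uncurry e i′ → i ≡ i′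
    inj {t , s} {t′ , s′} eq with injective (proj₂ S)
      (disjoint (proj₁ (e∈ t s)) (proj₂ (e∈ t s)) (subst (_∈ F (col t′)) (sym eq) (proj₂ (e∈ t′ s′))))
    ... | refl = cong (t ,_) (injective (proj₂ (f t)) eq)
    cmp : ∀ {x} → x ∈ p → ∃[ i ] uncurry e i ≡ x
    cmp x∈p with cover x∈p
    ... | d , x∈F with complete (proj₂ S) (∈-fromDec⁺ (λ d → nonempty? (p ∩ F d)) (_ , x∈p∩q⁺ (x∈p , x∈F)))
    ... | t , refl with complete (proj₂ (f t)) (x∈p∩q⁺ (x∈p , x∈F))
    ... | s , eq = (t , s) , eq

∣p∣≡suc-by : ∀ {n m} {I : Set} (p : Subset n) (φ : Fin m ↔ I) (x : Fin n) (e : I → Fin n) →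
             (∀ {i i′} → e i ≡ e i′ → i ≡ i′) → (∀ i → e i ≢ x) → x ∈ p → (∀ i → e i ∈ p) →
             (∀ {y} → y ∈ p → y ≡ x ⊎ ∃[ i ] e i ≡ y) → ∣ p ∣ ≡ suc m
∣p∣≡suc-by p φ x e e-inj e≢x x∈p e∈p cover =
  ∣p∣≡-by p (↔-trans Fin.+↔⊎ (Fin.1↔⊤ ⊎-↔ φ)) e′ inj snd cmp
  where
  e′ = Sum.[ (λ _ → x) , e ]′
  inj : ∀ {i i′} → e′ i ≡ e′ i′ → i ≡ i′
  inj {inj₁ _} {inj₁ _} _  = refl
  inj {inj₁ _} {inj₂ i} eq = contradiction (sym eq) (e≢x i)
  inj {inj₂ i} {inj₁ _} eq = contradiction eq (e≢x i)
  inj {inj₂ _} {inj₂ _} eq = cong inj₂ (e-inj eq)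
  snd : ∀ i → e′ i ∈ p
  snd (inj₁ _) = x∈p
  snd (inj₂ i) = e∈p i
  cmp : ∀ {y} → y ∈ p → ∃[ i ] e′ i ≡ y
  cmp y∈p with cover y∈p
  ... | inj₁ refl     = inj₁ _ , refl
  ... | inj₂ (i , eq) = inj₂ i , eq

-- Local grids

module Neighbours {n} (Γ : FiniteGraph n) where
  open FiniteGraph Γ

  ~⇒∈S₁ : ∀ {x y} → x ~ y → y ∈ sphere Γ 1 x
  ~⇒∈S₁ {x} x~y = ∈-fromDec⁺ (λ y → dist? Γ x y 1)
    ((_ , x~y , refl) , λ { {zero} _ refl → irrefl x~y ; {suc _} (s≤s ()) })

  ∈S₁⇒~ : ∀ {x y} → y ∈ sphere Γ 1 x → x ~ y
  ∈S₁⇒~ {x} y∈ with ∈-fromDec⁻ (λ y → dist? Γ x y 1) y∈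
  ... | (_ , x~y , refl) , _ = x~y

-- The indices `a`, `j`, `i` of `pt` are the row, the column and the place inside the α-clique that
-- replaces a grid vertex. The isomorphism is unpacked into vertices of Γ, which keeps membership
-- proofs out of the geometry.
record LocalGrid {n} (Γ : FiniteGraph n) (A r α : ℕ) (x : Fin n) : Set where
  open FiniteGraph Γ
  field
    pt     : Fin A → Fin r → Fin α → Fin n
    pt-nbr : ∀ {a j i} → x ~ pt a j i
    loc    : ∀ {z} → x ~ z → ∃[ a ] ∃[ j ] ∃[ i ] pt a j i ≡ z
    pt-inj : ∀ {a j i a′ j′ i′} → pt a j i ≡ pt a′ j′ i′ → a ≡ a′ × j ≡ j′ × i ≡ i′
    ~⇒≡    : ∀ {a j i a′ j′ i′} → pt a j i ~ pt a′ j′ i′ → a ≡ a′ ⊎ j ≡ j′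
    row-~  : ∀ {a j i j′ i′} → pt a j i ≢ pt a j′ i′ → pt a j i ~ pt a j′ i′
    col-~  : ∀ {a j i a′ i′} → pt a j i ≢ pt a′ j i′ → pt a j i ~ pt a′ j i′

module LocallyGrid {n} (Γ : FiniteGraph n) {A r α : ℕ}
  (local : ∀ x → LocalGrid Γ A r α x) (rows<cols : α * r < A * α) where

  open FiniteGraph Γ
  open Neighbours Γ
  module _ {x : Fin n} where open LocalGrid (local x) public hiding (pt)

  pt : ∀ x → Fin A → Fin r → Fin α → Fin n
  pt x = LocalGrid.pt (local x)

  ~⇒≢ : ∀ {u v} → u ~ v → u ≢ v
  ~⇒≢ u~v refl = irrefl u~v

  pt≢ : ∀ {x a j i} → pt x a j i ≢ x
  pt≢ = ≢-sym (~⇒≢ pt-nbr)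

  col? : ∀ x j w → Dec (w ≡ x ⊎ (∃[ a ] ∃[ i ] pt x a j i ≡ w))
  col? x j w = (w ≟ x) ⊎-dec any? (λ a → any? (λ i → pt x a j i ≟ w))

  row? : ∀ x a w → Dec (w ≡ x ⊎ (∃[ j ] ∃[ i ] pt x a j i ≡ w))
  row? x a w = (w ≟ x) ⊎-dec any? (λ j → any? (λ i → pt x a j i ≟ w))

  Col : ∀ x → Fin r → Subset n
  Col x j = fromDec (col? x j)

  Row : ∀ x → Fin A → Subset n
  Row x a = fromDec (row? x a)

  ∈Col⁻ : ∀ {x j w} → w ∈ Col x j → w ≡ x ⊎ (∃[ a ] ∃[ i ] pt x a j i ≡ w)
  ∈Col⁻ = ∈-fromDec⁻ (col? _ _)

  ∈Row⁻ : ∀ {x a w} → w ∈ Row x a → w ≡ x ⊎ (∃[ j ] ∃[ i ] pt x a j i ≡ w)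
  ∈Row⁻ = ∈-fromDec⁻ (row? _ _)

  centre∈Col : ∀ {x j} → x ∈ Col x j
  centre∈Col {x} {j} = ∈-fromDec⁺ (col? x j) (inj₁ refl)

  pt∈Col : ∀ {x a j i} → pt x a j i ∈ Col x j
  pt∈Col {x} {a} {j} {i} = ∈-fromDec⁺ (col? x j) (inj₂ (a , i , refl))

  centre∈Row : ∀ {x a} → x ∈ Row x a
  centre∈Row {x} {a} = ∈-fromDec⁺ (row? x a) (inj₁ refl)

  pt∈Row : ∀ {x a j i} → pt x a j i ∈ Row x a
  pt∈Row {x} {a} {j} {i} = ∈-fromDec⁺ (row? x a) (inj₂ (j , i , refl))

  pt∈Col⇒≡ : ∀ {x a j i j′} → pt x a j i ∈ Col x j′ → j ≡ j′
  pt∈Col⇒≡ pt∈ with ∈Col⁻ pt∈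
  ... | inj₁ eq           = contradiction eq pt≢
  ... | inj₂ (_ , _ , eq) = sym (proj₁ (proj₂ (pt-inj eq)))

  pt∈Row⇒≡ : ∀ {x a j i a′} → pt x a j i ∈ Row x a′ → a ≡ a′
  pt∈Row⇒≡ pt∈ with ∈Row⁻ pt∈
  ... | inj₁ eq           = contradiction eq pt≢
  ... | inj₂ (_ , _ , eq) = sym (proj₁ (pt-inj eq))

  Col-nbr : ∀ {x j w} → w ∈ Col x j → w ≢ x → x ~ w
  Col-nbr w∈ w≢x with ∈Col⁻ w∈
  ... | inj₁ w≡x            = contradiction w≡x w≢x
  ... | inj₂ (_ , _ , refl) = pt-nbr

  nbr∈Col : ∀ {x w} → x ~ w → ∃[ j ] w ∈ Col x j
  nbr∈Col x~w with loc x~w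
  ... | _ , j , _ , refl = j , pt∈Col

  Col-unique : ∀ {x w j j′} → x ~ w → w ∈ Col x j → w ∈ Col x j′ → j ≡ j′
  Col-unique x~w w∈ w∈′ with loc x~w
  ... | _ , _ , _ , refl = trans (sym (pt∈Col⇒≡ w∈)) (pt∈Col⇒≡ w∈′)

  Col-clique : ∀ x j → Clique Γ (Col x j)
  Col-clique x j u∈ v∈ u≢v with ∈Col⁻ u∈ | ∈Col⁻ v∈
  ... | inj₁ refl           | _                   = Col-nbr v∈ (≢-sym u≢v)
  ... | inj₂ (_ , _ , refl) | inj₁ refl           = ~-sym pt-nbr
  ... | inj₂ (_ , _ , refl) | inj₂ (_ , _ , refl) = col-~ u≢v

  Row-clique : ∀ x a → Clique Γ (Row x a)
  Row-clique x a u∈ v∈ u≢v with ∈Row⁻ u∈ | ∈Row⁻ v∈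
  ... | inj₁ refl           | inj₁ refl           = contradiction refl u≢v
  ... | inj₁ refl           | inj₂ (_ , _ , refl) = pt-nbr
  ... | inj₂ (_ , _ , refl) | inj₁ refl           = ~-sym pt-nbr
  ... | inj₂ (_ , _ , refl) | inj₂ (_ , _ , refl) = row-~ u≢v

  ∣Col∣ : ∀ x j → ∣ Col x j ∣ ≡ suc (A * α)
  ∣Col∣ x j = ∣p∣≡suc-by (Col x j) Fin.*↔× x (λ (a , i) → pt x a j i)
    (λ eq → let p , _ , q = pt-inj eq in cong₂ _,_ p q)
    (λ _ → pt≢) centre∈Col (λ _ → pt∈Col)
    (λ y∈ → Sum.map₂ (λ (a , i , eq) → (a , i) , eq) (∈Col⁻ y∈))

  ∣Row∣ : ∀ x a → ∣ Row x a ∣ ≡ suc (r * α)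
  ∣Row∣ x a = ∣p∣≡suc-by (Row x a) Fin.*↔× x (λ (j , i) → pt x a j i)
    (λ eq → let _ , p , q = pt-inj eq in cong₂ _,_ p q)
    (λ _ → pt≢) centre∈Row (λ _ → pt∈Row)
    (λ y∈ → Sum.map₂ (λ (j , i , eq) → (j , i) , eq) (∈Row⁻ y∈))

  -- A point `w` of `C` outside column `j` shares row `a` with the given point. Any other point of
  -- `C` that lies in column `j` must then share its row with `w`, hence lies in row `a` too.
  clique⊆Col⊎Row : ∀ {C x a j i} → Clique Γ C → x ∈ C → pt x a j i ∈ C → C ⊆ Col x j ⊎ C ⊆ Row x a
  clique⊆Col⊎Row {C} {x} {a} {j} {i} cl x∈C pt∈C
    with any? (λ w → (w ∈? C) ×-dec ¬? (w ∈? Col x j))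
  ... | no ∄ = inj₁ λ {w} w∈C → decidable-stable (w ∈? Col x j) λ w∉ → ∄ (w , w∈C , w∉)
  ... | yes (w , w∈C , w∉Col) = inj₂ in-row
    where
    nbr : ∀ {u} → u ∈ C → u ≢ x → ∃[ a ] ∃[ j ] ∃[ i ] pt x a j i ≡ u
    nbr u∈C u≢x = loc (cl x∈C u∈C (≢-sym u≢x))
    share : ∀ {b k l b′ k′ l′} → pt x b k l ∈ C → pt x b′ k′ l′ ∈ C → b ≡ b′ ⊎ k ≡ k′
    share {b} {k} {l} {b′} {k′} {l′} p∈ q∈ with pt x b k l ≟ pt x b′ k′ l′
    ... | yes eq = inj₁ (proj₁ (pt-inj eq))
    ... | no p≢q = ~⇒≡ (cl p∈ q∈ p≢q)
    in-row : C ⊆ Row x a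
    in-row {u} u∈C with u ≟ x
    ... | yes refl = centre∈Row
    ... | no u≢x with nbr w∈C (λ { refl → w∉Col centre∈Col }) | nbr u∈C u≢x
    ... | _ , _ , _ , refl | _ , _ , _ , refl with share u∈C pt∈C | share w∈C pt∈C | share u∈C w∈C
    ... | inj₁ refl | _         | _         = pt∈Row
    ... | inj₂ refl | inj₂ refl | _         = contradiction pt∈Col w∉Col
    ... | inj₂ refl | inj₁ refl | inj₁ refl = pt∈Row
    ... | inj₂ refl | inj₁ refl | inj₂ refl = contradiction pt∈Col w∉Col

  -- The assumption β > αr enters here: a row with its centre has only αr + 1 points, too few to
  -- contain `C`.
  big-clique : ∀ {C x a j i} → Clique Γ C → suc (A * α) ≤ ∣ C ∣ → x ∈ C → pt x a j i ∈ C → C ≡ Col x j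
  big-clique {C} {x} {a} {j} cl big x∈C pt∈C with clique⊆Col⊎Row cl x∈C pt∈C
  ... | inj₁ C⊆Col = ⊆∧∣∣≤⇒≡ C⊆Col (subst (_≤ ∣ C ∣) (sym (∣Col∣ x j)) big)
  ... | inj₂ C⊆Row = contradiction (begin-strict
      suc (r * α)   ≡⟨ cong suc (ℕ.*-comm r α) ⟩
      suc (α * r)   <⟨ s≤s rows<cols ⟩
      suc (A * α)   ≤⟨ big ⟩
      ∣ C ∣         ≤⟨ p⊆q⇒∣p∣≤∣q∣ C⊆Row ⟩
      ∣ Row x a ∣   ≡⟨ ∣Row∣ x a ⟩
      suc (r * α)   ∎) (ℕ.<-irrefl refl)
    where open ℕ.≤-Reasoning

  -- The column at `x` is itself a clique of size β + 1 through `u` and `x`, so `big-clique` applies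
  -- to it at `u`. Thus a line looks the same from each of its points.
  Col-sym : ∀ {x u j j′} → u ∈ Col x j → x ∈ Col u j′ → u ≢ x → Col x j ≡ Col u j′
  Col-sym {x} {u} {j} {j′} u∈ x∈ u≢x with ∈Col⁻ x∈
  ... | inj₁ x≡u            = contradiction (sym x≡u) u≢x
  ... | inj₂ (_ , _ , refl) =
    big-clique (Col-clique x j) (ℕ.≤-reflexive (sym (∣Col∣ x j))) u∈ centre∈Col

  -- Common neighbours of two nonadjacent vertices

  μ : Fin n → Fin n → Subset n
  μ x y = sphere Γ 1 x ∩ sphere Γ 1 y

  ∈μ⁺ : ∀ {x y w} → x ~ w → y ~ w → w ∈ μ x y
  ∈μ⁺ x~w y~w = x∈p∩q⁺ (~⇒∈S₁ x~w , ~⇒∈S₁ y~w)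

  ∈μ⁻ : ∀ {x y w} → w ∈ μ x y → x ~ w × y ~ w
  ∈μ⁻ {x} {y} w∈ = let p , q = x∈p∩q⁻ (sphere Γ 1 x) (sphere Γ 1 y) w∈ in ∈S₁⇒~ p , ∈S₁⇒~ q

  module Nonadjacent {x y} (x≢y : x ≢ y) (x≁y : ¬ x ~ y) where

    -- Seen from a common neighbour `z`, both `x` and `y` are grid points, and a shared row or
    -- column would make them adjacent. Hence a common neighbour of `x` and `y` that is adjacent to
    -- `z` lies in one of the two corner cells (a, j′) and (a′, j), each of α points.
    μ-coords : ∀ {z} → z ∈ μ x y →
      ∃[ a ] ∃[ j ] ∃[ i ] ∃[ a′ ] ∃[ j′ ] ∃[ i′ ]
      pt z a j i ≡ x × pt z a′ j′ i′ ≡ y × a ≢ a′ × j ≢ j′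
    μ-coords z∈ with loc (~-sym (proj₁ (∈μ⁻ z∈))) | loc (~-sym (proj₂ (∈μ⁻ z∈)))
    ... | a , j , i , refl | a′ , j′ , i′ , refl =
      a , j , i , a′ , j′ , i′ , refl , refl ,
      (λ { refl → x≁y (row-~ x≢y) }) , (λ { refl → x≁y (col-~ x≢y) })

    -- The line through `y` and `z` is column `j′` of `z`; besides `z`, its points adjacent to `x`
    -- are those of the corner cell (a, j′).
    ∣μ∩Col∣ : ∀ {z d} → z ∈ μ x y → z ∈ Col y d → ∣ μ x y ∩ Col y d ∣ ≡ suc α
    ∣μ∩Col∣ {z} {d} z∈μ z∈Col with μ-coords z∈μ
    ... | a , j , i , a′ , j′ , i′ , refl , refl , a≢a′ , j≢j′ =
      ∣p∣≡suc-by (μ x y ∩ Col y d) ↔-refl z (λ l → pt z a j′ l)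
        (proj₂ ∘ proj₂ ∘ pt-inj) (λ _ → pt≢) (x∈p∩q⁺ (z∈μ , z∈Col))
        (λ l → x∈p∩q⁺ (∈μ⁺ (row-~ (λ eq → j≢j′ (proj₁ (proj₂ (pt-inj eq)))))
                           (col-~ (λ eq → a≢a′ (sym (proj₁ (pt-inj eq))))) ,
                       subst (pt z a j′ l ∈_) same-line pt∈Col))
        cover
      where
      same-line : Col z j′ ≡ Col y d
      same-line = Col-sym pt∈Col z∈Col pt≢
      cover : ∀ {w} → w ∈ μ x y ∩ Col y d → w ≡ z ⊎ ∃[ l ] pt z a j′ l ≡ w
      cover {w} w∈ with x∈p∩q⁻ (μ x y) (Col y d) w∈
      ... | w∈μ , w∈Col with ∈Col⁻ (subst (w ∈_) (sym same-line) w∈Col)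
      ... | inj₁ w≡z = inj₁ w≡z
      ... | inj₂ (b , l , refl) with ~⇒≡ (proj₁ (∈μ⁻ w∈μ))
      ... | inj₁ refl = inj₂ (l , refl)
      ... | inj₂ j≡j′ = contradiction j≡j′ j≢j′

    -- Here the other corner cell (a′, j) counts. Rows have no analogue of `Col-sym` at this point,
    -- so the cell is first located in the local grid at `y`.
    ∣μ∩Row∣ : ∀ {z c} → z ∈ μ x y → z ∈ Row y c → ∣ μ x y ∩ Row y c ∣ ≡ suc α
    ∣μ∩Row∣ {z} {c} z∈μ z∈Row with μ-coords z∈μ | ∈Row⁻ z∈Row
    ... | _ | inj₁ refl = contradiction (proj₂ (∈μ⁻ z∈μ)) irrefl
    ... | a , j , i , a′ , j′ , i′ , refl , refl , a≢a′ , j≢j′ | inj₂ (d , k , z≡) =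
      ∣p∣≡suc-by (μ x y ∩ Row y c) ↔-refl z (λ l → pt z a′ j l)
        (proj₂ ∘ proj₂ ∘ pt-inj) (λ _ → pt≢) (x∈p∩q⁺ (z∈μ , z∈Row))
        (λ l → x∈p∩q⁺ (corner∈μ l , corner∈Row l))
        cover
      where
      same-line : Col z j′ ≡ Col y d
      same-line = Col-sym pt∈Col (subst (_∈ Col y d) z≡ pt∈Col) pt≢
      corner∈μ : ∀ l → pt z a′ j l ∈ μ x y
      corner∈μ l = ∈μ⁺ (col-~ (λ eq → a≢a′ (proj₁ (pt-inj eq))))
                       (row-~ (λ eq → j≢j′ (sym (proj₁ (proj₂ (pt-inj eq))))))
      -- At `y` the corner point shares a row or a column with its neighbour `z`. A shared column
      -- would put it on the line of `y` and `z`, which is column `j′` at `z`, whereas it is in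
      -- column `j` there.
      corner∈Row : ∀ l → pt z a′ j l ∈ Row y c
      corner∈Row l with loc (proj₂ (∈μ⁻ (corner∈μ l)))
      ... | c₂ , d₂ , k₂ , eq with ~⇒≡ (subst₂ _~_ (sym z≡) (sym eq) pt-nbr)
      ... | inj₁ refl = subst (_∈ Row y c) eq pt∈Row
      ... | inj₂ refl = contradiction
        (pt∈Col⇒≡ (subst₂ _∈_ eq (sym same-line) pt∈Col)) j≢j′
      cover : ∀ {w} → w ∈ μ x y ∩ Row y c → w ≡ z ⊎ ∃[ l ] pt z a′ j l ≡ w
      cover {w} w∈ with x∈p∩q⁻ (μ x y) (Row y c) w∈
      ... | w∈μ , w∈Row with w ≟ z | ∈Row⁻ w∈Row
      ... | yes w≡z | _         = inj₁ w≡z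
      ... | no _    | inj₁ refl = contradiction (proj₂ (∈μ⁻ w∈μ)) irrefl
      ... | no w≢z  | inj₂ (d₂ , k₂ , w≡)
        with loc (subst₂ _~_ z≡ w≡ (row-~ λ eq → w≢z (trans (sym w≡) (trans (sym eq) z≡))))
      ... | a₂ , j₂ , i₂ , refl
        with ~⇒≡ (proj₁ (∈μ⁻ w∈μ)) | ~⇒≡ (proj₂ (∈μ⁻ w∈μ))
      ... | inj₁ refl | inj₁ refl = contradiction refl a≢a′
      ... | inj₂ refl | inj₁ refl = inj₂ (i₂ , refl)
      ... | inj₂ refl | inj₂ refl = contradiction refl j≢j′
      -- At z the vertex w is in row a and column j′, so it is not adjacent to the corner
      -- in row a′ and column j, although both are in row c of y.
      ... | inj₁ refl | inj₂ refl with ∈Row⁻ (corner∈Row i)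
      ...   | inj₁ eq = contradiction (proj₁ (proj₂ (pt-inj eq))) j≢j′
      ...   | inj₂ (d₃ , k₃ , eq) with ~⇒≡ (subst₂ _~_ w≡ eq
                (row-~ λ e → a≢a′ (proj₁ (pt-inj (trans (sym w≡) (trans e eq))))))
      ...     | inj₁ a≡a′ = contradiction a≡a′ a≢a′
      ...     | inj₂ j′≡j = contradiction (sym j′≡j) j≢j′

  -- The local grid at `y` when `x` is at distance two

  module SecondNeighbour {b x y} (d₂ : Dist Γ x y 2)
    (c₂ : ∣ μ x y ∣ ≡ suc b * suc α)
    (b₂ : suc b ≤ r → suc b ≤ A →
          ∣ sphere Γ 3 x ∩ sphere Γ 1 y ∣ ≡ (A ∸ suc b) * ((r ∸ suc b) * α)) where

    x≢y : x ≢ y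
    x≢y = proj₂ d₂ {0} (s≤s z≤n)

    x≁y : ¬ x ~ y
    x≁y x~y = proj₂ d₂ {1} (s≤s (s≤s z≤n)) (_ , x~y , refl)

    open Nonadjacent x≢y x≁y

    T : Subset r
    T = support (μ x y) (Col y)

    S : Subset A
    S = support (μ x y) (Row y)

    μ≢y : ∀ {z} → z ∈ μ x y → z ≢ y
    μ≢y z∈ refl = x≁y (proj₁ (∈μ⁻ z∈))

    ∈S⁺ : ∀ {z a j i} → z ∈ μ x y → pt y a j i ≡ z → a ∈ S
    ∈S⁺ z∈μ refl = ∈-fromDec⁺ (λ c → nonempty? (μ x y ∩ Row y c)) (_ , x∈p∩q⁺ (z∈μ , pt∈Row))

    ∈T⁻ : ∀ {j} → j ∈ T → ∃₂ λ a i → pt y a j i ∈ μ x y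
    ∈T⁻ {j} j∈ with ∈-fromDec⁻ (λ d → nonempty? (μ x y ∩ Col y d)) j∈
    ... | z , z∈ with x∈p∩q⁻ (μ x y) (Col y j) z∈
    ... | z∈μ , z∈Col with ∈Col⁻ z∈Col
    ... | inj₁ z≡y            = contradiction z≡y (μ≢y z∈μ)
    ... | inj₂ (a , i , refl) = a , i , z∈μ

    ∈S⁻ : ∀ {a} → a ∈ S → ∃₂ λ j i → pt y a j i ∈ μ x y
    ∈S⁻ {a} a∈ with ∈-fromDec⁻ (λ c → nonempty? (μ x y ∩ Row y c)) a∈
    ... | z , z∈ with x∈p∩q⁻ (μ x y) (Row y a) z∈
    ... | z∈μ , z∈Row with ∈Row⁻ z∈Row
    ... | inj₁ z≡y            = contradiction z≡y (μ≢y z∈μ)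
    ... | inj₂ (j , i , refl) = j , i , z∈μ

    ∣T∣ : ∣ T ∣ ≡ suc b
    ∣T∣ = ℕ.*-cancelʳ-≡ ∣ T ∣ (suc b) (suc α) (trans (sym (∣p∣-fibres (μ x y) (Col y) (suc α)
      (λ z∈ → let _ , j , _ , eq = loc (proj₂ (∈μ⁻ z∈)) in j , subst (_∈ Col y j) eq pt∈Col)
      disjoint ∣μ∩Col∣)) c₂)
      where
      disjoint : ∀ {z d d′} → z ∈ μ x y → z ∈ Col y d → z ∈ Col y d′ → d ≡ d′
      disjoint z∈μ z∈ z∈′ with ∈Col⁻ z∈
      ... | inj₁ z≡y            = contradiction z≡y (μ≢y z∈μ)
      ... | inj₂ (_ , _ , refl) = pt∈Col⇒≡ z∈′

    ∣S∣ : ∣ S ∣ ≡ suc b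
    ∣S∣ = ℕ.*-cancelʳ-≡ ∣ S ∣ (suc b) (suc α) (trans (sym (∣p∣-fibres (μ x y) (Row y) (suc α)
      (λ z∈ → let a , _ , _ , eq = loc (proj₂ (∈μ⁻ z∈)) in a , subst (_∈ Row y a) eq pt∈Row)
      disjoint ∣μ∩Row∣)) c₂)
      where
      disjoint : ∀ {z c c′} → z ∈ μ x y → z ∈ Row y c → z ∈ Row y c′ → c ≡ c′
      disjoint z∈μ z∈ z∈′ with ∈Row⁻ z∈
      ... | inj₁ z≡y            = contradiction z≡y (μ≢y z∈μ)
      ... | inj₂ (_ , _ , refl) = pt∈Row⇒≡ z∈′

    -- Column `j` contains a common neighbour of `x` and `y`. It differs from the given point, since
    -- row `a` contains none, so the column joins the two.
    ∈T⇒Walk₂ : ∀ {a j i} → a ∉ S → j ∈ T → Walk Γ 2 x (pt y a j i)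
    ∈T⇒Walk₂ a∉S j∈T with ∈T⁻ j∈T
    ... | a′ , i′ , z∈ = _ , proj₁ (∈μ⁻ z∈) , _ ,
      col-~ (λ eq → a∉S (subst (_∈ S) (proj₁ (pt-inj eq)) (∈S⁺ z∈ refl))) , refl

    outside? : ∀ w → Dec (∃[ a ] ∃[ j ] ∃[ i ] (a ∉ S × j ∉ T × pt y a j i ≡ w))
    outside? w = any? λ a → any? λ j → any? λ i →
      ¬? (a ∈? S) ×-dec ¬? (j ∈? T) ×-dec (pt y a j i ≟ w)

    -- A point in the row or column of a common neighbour is at distance at most 2 from `x`, which
    -- gives one inclusion. The other one comes from counting: exactly b₂ grid points avoid all
    -- these rows and columns.
    Γ₃∩Γ₁≡outside : sphere Γ 3 x ∩ sphere Γ 1 y ≡ fromDec outside?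
    Γ₃∩Γ₁≡outside = ⊆∧∣∣≤⇒≡ sub (begin
      ∣ fromDec outside? ∣                 ≤⟨ ∣p∣≤-cover (fromDec outside?)
                                              (↔-trans Fin.*↔× (↔-refl ×-↔ Fin.*↔×)) e cover ⟩
      ∣ ∁ S ∣ * (∣ ∁ T ∣ * α)              ≡⟨ cong₂ (λ s t → s * (t * α)) (∣∁p∣≡n∸∣p∣ S) (∣∁p∣≡n∸∣p∣ T) ⟩
      (A ∸ ∣ S ∣) * ((r ∸ ∣ T ∣) * α)      ≡⟨ cong₂ (λ s t → (A ∸ s) * ((r ∸ t) * α)) ∣S∣ ∣T∣ ⟩
      -- The guards of `b₂`, which keep the truncated subtractions exact, hold because `T` and `S`
      -- are sets of b + 1 columns and b + 1 rows.
      (A ∸ suc b) * ((r ∸ suc b) * α)      ≡⟨ b₂ (subst (_≤ r) ∣T∣ (∣p∣≤n T)) (subst (_≤ A) ∣S∣ (∣p∣≤n S)) ⟨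
      ∣ sphere Γ 3 x ∩ sphere Γ 1 y ∣      ∎)
      where
      open ℕ.≤-Reasoning
      e : Fin ∣ ∁ S ∣ × (Fin ∣ ∁ T ∣ × Fin α) → Fin n
      e (s , t , i) = pt y (proj₁ (enumerate (∁ S)) s) (proj₁ (enumerate (∁ T)) t) i
      cover : ∀ {w} → w ∈ fromDec outside? → ∃[ t ] e t ≡ w
      cover w∈ with ∈-fromDec⁻ outside? w∈
      ... | a , j , i , a∉S , j∉T , refl
        with complete (proj₂ (enumerate (∁ S))) (x∉p⇒x∈∁p a∉S)
           | complete (proj₂ (enumerate (∁ T))) (x∉p⇒x∈∁p j∉T)
      ... | s , refl | t , refl = (s , t , i) , refl
      sub : sphere Γ 3 x ∩ sphere Γ 1 y ⊆ fromDec outside?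
      sub {w} w∈ with x∈p∩q⁻ (sphere Γ 3 x) (sphere Γ 1 y) w∈
      ... | w∈₃ , w∈₁ with ∈-fromDec⁻ (λ w → dist? Γ x w 3) w∈₃ | loc (∈S₁⇒~ w∈₁)
      ... | _ , far | a , j , i , refl = ∈-fromDec⁺ outside? (a , j , i ,
        (λ a∈S → let _ , _ , z∈ = ∈S⁻ a∈S in near z∈ row-~) ,
        (λ j∈T → let _ , _ , z∈ = ∈T⁻ j∈T in near z∈ col-~) , refl)
        where
        near : ∀ {z} → z ∈ μ x y → (z ≢ w → z ~ w) → ⊥
        near {z} z∈ z~w with z ≟ w
        ... | yes refl = far {1} (s≤s (s≤s z≤n)) (_ , proj₁ (∈μ⁻ z∈) , refl)
        ... | no z≢w   = far {2} (s≤s (s≤s (s≤s z≤n))) (_ , proj₁ (∈μ⁻ z∈) , _ , z~w z≢w , refl)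

    Walk₂⇒∈T : ∀ {a j i} → a ∉ S → Walk Γ 2 x (pt y a j i) → j ∈ T
    Walk₂⇒∈T {a} {j} {i} a∉S walk = decidable-stable (j ∈? T) λ j∉T →
      let w∈₃ , _ = x∈p∩q⁻ (sphere Γ 3 x) (sphere Γ 1 y)
            (subst (pt y a j i ∈_) (sym Γ₃∩Γ₁≡outside)
              (∈-fromDec⁺ outside? (a , j , i , a∉S , j∉T , refl)))
      in proj₂ (∈-fromDec⁻ (λ w → dist? Γ x w 3) w∈₃) {2} (s≤s (s≤s (s≤s z≤n))) walk

-- Rational sums

-- `fromℤ` normalises its fraction, so the arithmetic laws below are checked on unnormalised
-- fractions, where the second argument 0 of `mkℚᵘ` encodes the denominator 1.
toℚᵘ-fromℤ : ∀ i → toℚᵘ (fromℤ i) ℚᵘ.≃ mkℚᵘ i 0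
toℚᵘ-fromℤ i = ℚ.toℚᵘ-fromℚᵘ (mkℚᵘ i 0)

fromℤ-+ : ∀ i j → fromℤ (i ℤ.+ j) ≡ fromℤ i ℚ.+ fromℤ j
fromℤ-+ i j = ℚ.toℚᵘ-injective (begin
  toℚᵘ (fromℤ (i ℤ.+ j))              ≈⟨ toℚᵘ-fromℤ (i ℤ.+ j) ⟩
  mkℚᵘ (i ℤ.+ j) 0                    ≡⟨ cong₂ (λ k l → mkℚᵘ (k ℤ.+ l) 0) (ℤ.*-identityʳ i) (ℤ.*-identityʳ j) ⟨
  mkℚᵘ i 0 ℚᵘ.+ mkℚᵘ j 0              ≈⟨ ℚᵘ.+-cong (toℚᵘ-fromℤ i) (toℚᵘ-fromℤ j) ⟨
  toℚᵘ (fromℤ i) ℚᵘ.+ toℚᵘ (fromℤ j)  ≈⟨ ℚ.toℚᵘ-homo-+ (fromℤ i) (fromℤ j) ⟨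
  toℚᵘ (fromℤ i ℚ.+ fromℤ j)          ∎)
  where open ℚᵘ.≃-Reasoning

fromℤ-* : ∀ i j → fromℤ (i ℤ.* j) ≡ fromℤ i ℚ.* fromℤ j
fromℤ-* i j = ℚ.toℚᵘ-injective (begin
  toℚᵘ (fromℤ (i ℤ.* j))              ≈⟨ toℚᵘ-fromℤ (i ℤ.* j) ⟩
  mkℚᵘ i 0 ℚᵘ.* mkℚᵘ j 0              ≈⟨ ℚᵘ.*-cong (toℚᵘ-fromℤ i) (toℚᵘ-fromℤ j) ⟨
  toℚᵘ (fromℤ i) ℚᵘ.* toℚᵘ (fromℤ j)  ≈⟨ ℚ.toℚᵘ-homo-* (fromℤ i) (fromℤ j) ⟨
  toℚᵘ (fromℤ i ℚ.* fromℤ j)          ∎)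
  where open ℚᵘ.≃-Reasoning

fromℤ-neg : ∀ i → fromℤ (ℤ.- i) ≡ ℚ.- fromℤ i
fromℤ-neg i = ℚ.toℚᵘ-injective (begin
  toℚᵘ (fromℤ (ℤ.- i))      ≈⟨ toℚᵘ-fromℤ (ℤ.- i) ⟩
  ℚᵘ.- mkℚᵘ i 0             ≈⟨ ℚᵘ.-‿cong (toℚᵘ-fromℤ i) ⟨
  ℚᵘ.- toℚᵘ (fromℤ i)       ≈⟨ ℚ.toℚᵘ-homo‿- (fromℤ i) ⟨
  toℚᵘ (ℚ.- fromℤ i)        ∎)
  where open ℚᵘ.≃-Reasoning

fromℤ-sub : ∀ i j → fromℤ (i ℤ.- j) ≡ fromℤ i ℚ.- fromℤ j
fromℤ-sub i j = trans (fromℤ-+ i (ℤ.- j)) (cong (fromℤ i ℚ.+_) (fromℤ-neg j))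

fromℤ-injective : ∀ {i j} → fromℤ i ≡ fromℤ j → i ≡ j
fromℤ-injective {i} {j} eq
  with ℚᵘ.≃-trans (ℚᵘ.≃-sym (toℚᵘ-fromℤ i)) (ℚᵘ.≃-trans (ℚᵘ.≃-reflexive (cong toℚᵘ eq)) (toℚᵘ-fromℤ j))
... | *≡* i*1≡j*1 = trans (sym (ℤ.*-identityʳ i)) (trans i*1≡j*1 (ℤ.*-identityʳ j))

fromℤ-mono-≤ : ∀ {i j} → i ℤ.≤ j → fromℤ i ℚ.≤ fromℤ j
fromℤ-mono-≤ {i} {j} i≤j = ℚ.toℚᵘ-cancel-≤ (ℚᵘ.≤-respʳ-≃ (ℚᵘ.≃-sym (toℚᵘ-fromℤ j))
  (ℚᵘ.≤-respˡ-≃ (ℚᵘ.≃-sym (toℚᵘ-fromℤ i))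
    (*≤* (subst₂ ℤ._≤_ (sym (ℤ.*-identityʳ i)) (sym (ℤ.*-identityʳ j)) i≤j))))

fromℕ-+ : ∀ m n → fromℕ (m ℕ.+ n) ≡ fromℕ m ℚ.+ fromℕ n
fromℕ-+ m n = fromℤ-+ (+ m) (+ n)

fromℕ-* : ∀ m n → fromℕ (m ℕ.* n) ≡ fromℕ m ℚ.* fromℕ n
fromℕ-* m n = trans (cong fromℤ (ℤ.pos-* m n)) (fromℤ-* (+ m) (+ n))

fromℕ-mono-≤ : ∀ {m n} → m ℕ.≤ n → fromℕ m ℚ.≤ fromℕ n
fromℕ-mono-≤ m≤n = fromℤ-mono-≤ (ℤ.+≤+ m≤n)

0≤fromℕ : ∀ m → 0ℚ ℚ.≤ fromℕ m
0≤fromℕ m = fromℕ-mono-≤ {0} {m} ℕ.z≤n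

*-nonNeg : ∀ {p q} → 0ℚ ℚ.≤ p → 0ℚ ℚ.≤ q → 0ℚ ℚ.≤ p ℚ.* q
*-nonNeg {p} {q} 0≤p 0≤q = ℚ.nonNegative⁻¹ (p ℚ.* q)
  {{ℚ.nonNeg*nonNeg⇒nonNeg p {{ℚ.nonNegative 0≤p}} q {{ℚ.nonNegative 0≤q}}}}

square-nonNeg : ∀ p → 0ℚ ℚ.≤ p ℚ.* p
square-nonNeg p with ℚ.∣p∣≡p∨∣p∣≡-p p
... | inj₁ eq = subst (λ q → 0ℚ ℚ.≤ q ℚ.* q) eq (*-nonNeg (ℚ.0≤∣p∣ p) (ℚ.0≤∣p∣ p))
... | inj₂ eq = subst (0ℚ ℚ.≤_) neg*neg (*-nonNeg (ℚ.0≤∣p∣ p) (ℚ.0≤∣p∣ p))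
  where
  neg*neg : ℚ.∣ p ∣ ℚ.* ℚ.∣ p ∣ ≡ p ℚ.* p
  neg*neg rewrite eq = solve 1 (λ p → (:- p) :* (:- p) := p :* p) refl p
    where open ℚS.+-*-Solver

∣∣≤⇒square≤ : ∀ {p q} → ℚ.∣ p ∣ ℚ.≤ q → p ℚ.* p ℚ.≤ q ℚ.* q
∣∣≤⇒square≤ {p} {q} ∣p∣≤q = begin
  p ℚ.* p                  ≡⟨ ℚ.0≤p⇒∣p∣≡p (square-nonNeg p) ⟨
  ℚ.∣ p ℚ.* p ∣            ≡⟨ ℚ.∣p*q∣≡∣p∣*∣q∣ p p ⟩
  ℚ.∣ p ∣ ℚ.* ℚ.∣ p ∣      ≤⟨ ℚ.*-monoˡ-≤-nonNeg ℚ.∣ p ∣ {{ℚ.nonNegative (ℚ.0≤∣p∣ p)}} ∣p∣≤q ⟩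
  ℚ.∣ p ∣ ℚ.* q            ≤⟨ ℚ.*-monoʳ-≤-nonNeg q {{ℚ.nonNegative (ℚ.≤-trans (ℚ.0≤∣p∣ p) ∣p∣≤q)}} ∣p∣≤q ⟩
  q ℚ.* q                  ∎
  where open ℚ.≤-Reasoning

sum-nonNeg : ∀ {n} (f : Fin n → ℚ) → (∀ i → 0ℚ ℚ.≤ f i) → 0ℚ ℚ.≤ sum f
sum-nonNeg {zero}  f 0≤f = ℚ.≤-refl
sum-nonNeg {suc n} f 0≤f = ℚ.+-mono-≤ (0≤f zero) (sum-nonNeg (f ∘ suc) (0≤f ∘ suc))

sum-mono-≤ : ∀ {n} (f g : Fin n → ℚ) → (∀ i → f i ℚ.≤ g i) → sum f ℚ.≤ sum g
sum-mono-≤ {zero}  f g f≤g = ℚ.≤-refl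
sum-mono-≤ {suc n} f g f≤g = ℚ.+-mono-≤ (f≤g zero) (sum-mono-≤ (f ∘ suc) (g ∘ suc) (f≤g ∘ suc))

sum-zero : ∀ {n} (f : Fin n → ℚ) → (∀ i → f i ≡ 0ℚ) → sum f ≡ 0ℚ
sum-zero {n} f f≡0 = trans (sum-cong-≗ f≡0) (sum-replicate-zero n)

sum-const : ∀ n q → sum {n} (λ _ → q) ≡ fromℕ n ℚ.* q
sum-const zero    q = sym (ℚ.*-zeroˡ q)
sum-const (suc n) q = begin
  q ℚ.+ sum {n} (λ _ → q)      ≡⟨ cong₂ ℚ._+_ (sym (ℚ.*-identityˡ q)) (sum-const n q) ⟩
  1ℚ ℚ.* q ℚ.+ fromℕ n ℚ.* q   ≡⟨ ℚ.*-distribʳ-+ q 1ℚ (fromℕ n) ⟨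
  (1ℚ ℚ.+ fromℕ n) ℚ.* q       ≡⟨ cong (ℚ._* q) (fromℕ-+ 1 n) ⟨
  fromℕ (suc n) ℚ.* q          ∎
  where open ≡-Reasoning

sum-single : ∀ {n} (f : Fin n → ℚ) i → (∀ j → j ≢ i → f j ≡ 0ℚ) → sum f ≡ f i
sum-single f zero    else0 = trans (cong (f zero ℚ.+_) (sum-zero (f ∘ suc) λ j → else0 (suc j) λ ()))
                                   (ℚ.+-identityʳ (f zero))
sum-single f (suc i) else0 = trans (cong₂ ℚ._+_ (else0 zero λ ())
                                     (sum-single (f ∘ suc) i λ j j≢i → else0 (suc j) (j≢i ∘ Fin.suc-injective)))
                                   (ℚ.+-identityˡ (f (suc i)))

χ : ∀ {n} → Subset n → Fin n → ℚ
χ p x = if lookup p x then 1ℚ else 0ℚ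

χ-∈ : ∀ {n} {p : Subset n} {x} → x ∈ p → χ p x ≡ 1ℚ
χ-∈ x∈p rewrite []=⇒lookup x∈p = refl

χ-∉ : ∀ {n} {p : Subset n} {x} → x ∉ p → χ p x ≡ 0ℚ
χ-∉ {p = p} {x} x∉p with lookup p x in eq
... | true  = contradiction (lookup⇒[]= x p eq) x∉p
... | false = refl

sum-χ : ∀ {n} (p : Subset n) → sum (χ p) ≡ fromℕ ∣ p ∣
sum-χ []            = refl
sum-χ (inside  ∷ p) = trans (cong (1ℚ ℚ.+_) (sum-χ p)) (sym (fromℕ-+ 1 ∣ p ∣))
sum-χ (outside ∷ p) = trans (ℚ.+-identityˡ (sum (χ p))) (sum-χ p)

-- Positive semidefiniteness of A + rI

module _ {n} (Γ : FiniteGraph n) where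
  open FiniteGraph Γ

  -- Lines are indexed by a vertex and a number at that vertex, which avoids choosing a
  -- representative for each line; `swap` says that the listings at two points of a line agree.
  module LineSpace {r k} (L : Fin n → Fin r → Subset n)
    (centre : ∀ {x j} → x ∈ L x j)
    (size   : ∀ x j → ∣ L x j ∣ ≡ suc k)
    (nbr    : ∀ {x j w} → w ∈ L x j → w ≢ x → x ~ w)
    (line   : ∀ {x w} → x ~ w → ∃[ j ] w ∈ L x j)
    (unique : ∀ {x w j j′} → x ~ w → w ∈ L x j → w ∈ L x j′ → j ≡ j′)
    (swap   : ∀ {x u j j′} → u ∈ L x j → x ∈ L u j′ → u ≢ x → L x j ≡ L u j′) where

    A : Fin n → Fin n → ℚ
    A = adjacency Γ

    δ : Fin n → Fin n → ℚ
    δ x y = if does (x ≟ y) then 1ℚ else 0ℚ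

    -- This is an entry of N Nᵀ = rI + A: there are r lines through a vertex, one through two
    -- adjacent vertices and none through two nonadjacent ones.
    lines-through-pair : ∀ x w → sum (λ j → χ (L x j) w) ≡ fromℕ r ℚ.* δ x w ℚ.+ A x w
    lines-through-pair x w with x ≟ w
    ... | yes refl rewrite dec-false (x ~? x) irrefl = begin
      sum (λ j → χ (L x j) x)    ≡⟨ sum-cong-≗ {r} (λ j → χ-∈ centre) ⟩
      sum {r} (λ j → 1ℚ)         ≡⟨ sum-const r 1ℚ ⟩
      fromℕ r ℚ.* 1ℚ             ≡⟨ ℚ.+-identityʳ _ ⟨
      fromℕ r ℚ.* 1ℚ ℚ.+ 0ℚ      ∎
      where open ≡-Reasoning
    ... | no x≢w with x ~? w
    ... | yes x~w = let j , w∈ = line x~w in begin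
      sum (λ j → χ (L x j) w)    ≡⟨ sum-single (λ j → χ (L x j) w) j (λ j′ j′≢j →
                                      χ-∉ λ w∈′ → j′≢j (unique x~w w∈′ w∈)) ⟩
      χ (L x j) w                ≡⟨ χ-∈ w∈ ⟩
      1ℚ                         ≡⟨ cong (ℚ._+ 1ℚ) (ℚ.*-zeroʳ (fromℕ r)) ⟨
      fromℕ r ℚ.* 0ℚ ℚ.+ 1ℚ      ∎
      where open ≡-Reasoning
    ... | no x≁w = begin
      sum (λ j → χ (L x j) w)    ≡⟨ sum-zero (λ j → χ (L x j) w) (λ j → χ-∉ λ w∈ → x≁w (nbr w∈ (≢-sym x≢w))) ⟩
      0ℚ                         ≡⟨ cong (ℚ._+ 0ℚ) (ℚ.*-zeroʳ (fromℕ r)) ⟨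
      fromℕ r ℚ.* 0ℚ ℚ.+ 0ℚ      ∎
      where open ≡-Reasoning

    module _ (v : Fin n → ℚ) where

      σ : Subset n → ℚ
      σ p = sum (λ w → χ p w ℚ.* v w)

      -- On a line, `σ` is the entry of Nᵀv, so the left side is the entry of N Nᵀ v at `x`.
      sum-σ : ∀ x → sum (λ j → σ (L x j)) ≡ fromℕ r ℚ.* v x ℚ.+ sum (λ w → A x w ℚ.* v w)
      sum-σ x = begin
        sum (λ j → sum (λ w → χ (L x j) w ℚ.* v w))
          ≡⟨ ∑-comm (λ j w → χ (L x j) w ℚ.* v w) ⟩
        sum (λ w → sum (λ j → χ (L x j) w ℚ.* v w))
          ≡⟨ sum-cong-≗ (λ w → *-distribʳ-sum (v w) (λ j → χ (L x j) w)) ⟨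
        sum (λ w → sum (λ j → χ (L x j) w) ℚ.* v w)
          ≡⟨ sum-cong-≗ (λ w → trans (cong (ℚ._* v w) (lines-through-pair x w))
                                     (ℚ.*-distribʳ-+ (v w) (fromℕ r ℚ.* δ x w) (A x w))) ⟩
        sum (λ w → fromℕ r ℚ.* δ x w ℚ.* v w ℚ.+ A x w ℚ.* v w)
          ≡⟨ ∑-distrib-+ (λ w → fromℕ r ℚ.* δ x w ℚ.* v w) (λ w → A x w ℚ.* v w) ⟩
        sum (λ w → fromℕ r ℚ.* δ x w ℚ.* v w) ℚ.+ sum (λ w → A x w ℚ.* v w)
          ≡⟨ cong (ℚ._+ sum (λ w → A x w ℚ.* v w)) (trans (sum-single (λ w → fromℕ r ℚ.* δ x w ℚ.* v w) x off) on) ⟩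
        fromℕ r ℚ.* v x ℚ.+ sum (λ w → A x w ℚ.* v w)
          ∎
        where
        open ≡-Reasoning
        off : ∀ w → w ≢ x → fromℕ r ℚ.* δ x w ℚ.* v w ≡ 0ℚ
        off w w≢x rewrite dec-false (x ≟ w) (≢-sym w≢x) | ℚ.*-zeroʳ (fromℕ r) = ℚ.*-zeroˡ (v w)
        on : fromℕ r ℚ.* δ x x ℚ.* v x ≡ fromℕ r ℚ.* v x
        on rewrite dec-true (x ≟ x) refl = cong (ℚ._* v x) (ℚ.*-identityʳ (fromℕ r))

      pair : Fin n → Fin n → ℚ
      pair x u = sum (λ j → χ (L x j) u ℚ.* σ (L x j))

      pair-line : ∀ {x u j} → x ~ u → u ∈ L x j → pair x u ≡ σ (L x j)
      pair-line {x} {u} {j} x~u u∈ = begin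
        pair x u                        ≡⟨ sum-single (λ j → χ (L x j) u ℚ.* σ (L x j)) j (λ j′ j′≢j →
                                             trans (cong (ℚ._* σ (L x j′)) (χ-∉ λ u∈′ → j′≢j (unique x~u u∈′ u∈)))
                                                   (ℚ.*-zeroˡ (σ (L x j′)))) ⟩
        χ (L x j) u ℚ.* σ (L x j)       ≡⟨ cong (ℚ._* σ (L x j)) (χ-∈ u∈) ⟩
        1ℚ ℚ.* σ (L x j)                ≡⟨ ℚ.*-identityˡ (σ (L x j)) ⟩
        σ (L x j)                       ∎
        where open ≡-Reasoning

      pair-none : ∀ {x u} → u ≢ x → ¬ x ~ u → pair x u ≡ 0ℚ
      pair-none {x} u≢x x≁u = sum-zero _ λ j →
        trans (cong (ℚ._* σ (L x j)) (χ-∉ λ u∈ → x≁u (nbr u∈ u≢x))) (ℚ.*-zeroˡ (σ (L x j)))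

      -- The lines through both points are the same whether listed at `x` or at `u`. This allows
      -- `squares` to pass from the vertex at which a line is listed to any other point on it.
      pair-comm : ∀ x u → pair x u ≡ pair u x
      pair-comm x u with x ≟ u | x ~? u
      ... | yes refl | _       = refl
      ... | no x≢u   | yes x~u =
        let j , u∈ = line x~u ; j′ , x∈ = line (~-sym x~u) in
        trans (pair-line x~u u∈) (trans (cong σ (swap u∈ x∈ (≢-sym x≢u))) (sym (pair-line (~-sym x~u) x∈)))
      ... | no x≢u   | no x≁u  = trans (pair-none (≢-sym x≢u) x≁u) (sym (pair-none x≢u (x≁u ∘ ~-sym)))

      -- The quadratic form vᵀ(rI + A)v.
      form : ℚ
      form = sum (λ x → v x ℚ.* (fromℕ r ℚ.* v x ℚ.+ sum (λ w → A x w ℚ.* v w)))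

      -- Each line is listed once for each of its k + 1 points.
      squares : sum (λ x → sum (λ j → σ (L x j) ℚ.* σ (L x j))) ≡ fromℕ (suc k) ℚ.* form
      squares = begin
        sum (λ x → sum (λ j → σ (L x j) ℚ.* σ (L x j)))
          ≡⟨ sum-cong-≗ (λ x → sum-cong-≗ (λ j → *-distribʳ-sum (σ (L x j)) (λ u → χ (L x j) u ℚ.* v u))) ⟩
        sum (λ x → sum (λ j → sum (λ u → χ (L x j) u ℚ.* v u ℚ.* σ (L x j))))
          ≡⟨ sum-cong-≗ (λ x → ∑-comm (λ j u → χ (L x j) u ℚ.* v u ℚ.* σ (L x j))) ⟩
        sum (λ x → sum (λ u → sum (λ j → χ (L x j) u ℚ.* v u ℚ.* σ (L x j))))
          ≡⟨ sum-cong-≗ (λ x → sum-cong-≗ (λ u → trans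
               (sum-cong-≗ (λ j → rearrange (χ (L x j) u) (v u) (σ (L x j))))
               (sym (*-distribˡ-sum (v u) (λ j → χ (L x j) u ℚ.* σ (L x j)))))) ⟩
        sum (λ x → sum (λ u → v u ℚ.* pair x u))
          ≡⟨ ∑-comm (λ x u → v u ℚ.* pair x u) ⟩
        sum (λ u → sum (λ x → v u ℚ.* pair x u))
          ≡⟨ sum-cong-≗ (λ u → trans (sym (*-distribˡ-sum (v u) (λ x → pair x u))) (cong (v u ℚ.*_) (pairs u))) ⟩
        sum (λ u → v u ℚ.* (fromℕ (suc k) ℚ.* (fromℕ r ℚ.* v u ℚ.+ sum (λ w → A u w ℚ.* v w))))
          ≡⟨ sum-cong-≗ (λ u → exchange (v u) (fromℕ (suc k)) (fromℕ r ℚ.* v u ℚ.+ sum (λ w → A u w ℚ.* v w))) ⟩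
        sum (λ u → fromℕ (suc k) ℚ.* (v u ℚ.* (fromℕ r ℚ.* v u ℚ.+ sum (λ w → A u w ℚ.* v w))))
          ≡⟨ *-distribˡ-sum (fromℕ (suc k)) (λ u → v u ℚ.* (fromℕ r ℚ.* v u ℚ.+ sum (λ w → A u w ℚ.* v w))) ⟨
        fromℕ (suc k) ℚ.* form
          ∎
        where
        open ≡-Reasoning
        open ℚS.+-*-Solver
        rearrange : ∀ a b c → a ℚ.* b ℚ.* c ≡ b ℚ.* (a ℚ.* c)
        rearrange = solve 3 (λ a b c → a :* b :* c := b :* (a :* c)) refl
        exchange : ∀ a b c → a ℚ.* (b ℚ.* c) ≡ b ℚ.* (a ℚ.* c)
        exchange = solve 3 (λ a b c → a :* (b :* c) := b :* (a :* c)) refl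
        -- Once the lines are listed at `u`, summing over `x` counts the k + 1 points of each line.
        pairs : ∀ u → sum (λ x → pair x u) ≡ fromℕ (suc k) ℚ.* (fromℕ r ℚ.* v u ℚ.+ sum (λ w → A u w ℚ.* v w))
        pairs u = begin
          sum (λ x → pair x u)
            ≡⟨ sum-cong-≗ (λ x → pair-comm x u) ⟩
          sum (λ x → sum (λ j → χ (L u j) x ℚ.* σ (L u j)))
            ≡⟨ ∑-comm (λ x j → χ (L u j) x ℚ.* σ (L u j)) ⟩
          sum (λ j → sum (λ x → χ (L u j) x ℚ.* σ (L u j)))
            ≡⟨ sum-cong-≗ (λ j → trans (sym (*-distribʳ-sum (σ (L u j)) (χ (L u j))))
                 (cong (ℚ._* σ (L u j)) (trans (sum-χ (L u j)) (cong fromℕ (size u j))))) ⟩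
          sum (λ j → fromℕ (suc k) ℚ.* σ (L u j))
            ≡⟨ *-distribˡ-sum (fromℕ (suc k)) (λ j → σ (L u j)) ⟨
          fromℕ (suc k) ℚ.* sum (λ j → σ (L u j))
            ≡⟨ cong (fromℕ (suc k) ℚ.*_) (sum-σ u) ⟩
          fromℕ (suc k) ℚ.* (fromℕ r ℚ.* v u ℚ.+ sum (λ w → A u w ℚ.* v w))
            ∎

      form-nonNeg : 0ℚ ℚ.≤ form
      form-nonNeg = ℚ.*-cancelˡ-≤-pos (fromℕ (suc k)) {{positive}} (begin
        fromℕ (suc k) ℚ.* 0ℚ                               ≡⟨ ℚ.*-zeroʳ (fromℕ (suc k)) ⟩
        0ℚ                                                 ≤⟨ sum-nonNeg (λ x → sum (λ j → σ (L x j) ℚ.* σ (L x j)))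
                                                              (λ x → sum-nonNeg (λ j → σ (L x j) ℚ.* σ (L x j))
                                                                (λ j → square-nonNeg (σ (L x j)))) ⟩
        sum (λ x → sum (λ j → σ (L x j) ℚ.* σ (L x j)))    ≡⟨ squares ⟩
        fromℕ (suc k) ℚ.* form                             ∎)
        where
        open ℚ.≤-Reasoning
        positive : ℚ.Positive (fromℕ (suc k))
        positive = ℚ.positive (ℚ.<-≤-trans (ℚ.positive⁻¹ 1ℚ) (fromℕ-mono-≤ {1} {suc k} (ℕ.s≤s ℕ.z≤n)))

-- Bounds on eigenvalues

-- Finitely many thresholds have a maximum, so all coordinates of an eigenvector can be approximated
-- at one index.
eventually-∀ : ∀ {n} {P : Fin n → ℕ → Set} → (∀ x → ∃[ N ] (∀ p → N ℕ.≤ p → P x p)) →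
               ∃[ N ] (∀ p → N ℕ.≤ p → ∀ x → P x p)
eventually-∀ {zero}  ev = 0 , λ _ _ ()
eventually-∀ {suc n} ev =
  let N , h = ev zero ; N′ , h′ = eventually-∀ (ev ∘ suc)
  in N ℕ.⊔ N′ , λ { p N≤p zero    → h p (ℕ.≤-trans (ℕ.m≤m⊔n N N′) N≤p)
                  ; p N≤p (suc x) → h′ p (ℕ.≤-trans (ℕ.m≤n⊔m N N′) N≤p) x }

square-small : ∀ m {ε} → 0ℚ ℚ.< ε → ∃[ δ ] (0ℚ ℚ.< δ × fromℕ m ℚ.* (δ ℚ.* δ) ℚ.≤ ε ℚ.* ε)
-- The witness is δ = ε / (m + 1); the successor keeps the divisor nonzero when m = 0.
square-small m {ε} 0<ε = ε ℚ.* t , *-pos 0<ε 0<t , (begin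
  fromℕ m ℚ.* (ε ℚ.* t ℚ.* (ε ℚ.* t))         ≡⟨ solve 3 (λ m e t → m :* (e :* t :* (e :* t)) := m :* t :* (e :* e) :* t)
                                                   refl (fromℕ m) ε t ⟩
  fromℕ m ℚ.* t ℚ.* (ε ℚ.* ε) ℚ.* t           ≤⟨ ℚ.*-monoʳ-≤-nonNeg t {{ℚ.nonNegative 0≤t}}
                                                   (ℚ.*-monoʳ-≤-nonNeg (ε ℚ.* ε) {{ℚ.nonNegative (square-nonNeg ε)}}
                                                     (scaled (fromℕ-mono-≤ (ℕ.n≤1+n m)))) ⟩
  M ℚ.* t ℚ.* (ε ℚ.* ε) ℚ.* t                 ≡⟨ cong (λ q → q ℚ.* (ε ℚ.* ε) ℚ.* t) Mt≡1 ⟩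
  1ℚ ℚ.* (ε ℚ.* ε) ℚ.* t                      ≡⟨ cong (ℚ._* t) (ℚ.*-identityˡ (ε ℚ.* ε)) ⟩
  ε ℚ.* ε ℚ.* t                               ≤⟨ ℚ.*-monoˡ-≤-nonNeg (ε ℚ.* ε) {{ℚ.nonNegative (square-nonNeg ε)}} t≤1 ⟩
  ε ℚ.* ε ℚ.* 1ℚ                              ≡⟨ ℚ.*-identityʳ (ε ℚ.* ε) ⟩
  ε ℚ.* ε                                     ∎)
  where
  open ℚ.≤-Reasoning
  open ℚS.+-*-Solver
  M = fromℕ (suc m)
  1≤M : 1ℚ ℚ.≤ M
  1≤M = fromℕ-mono-≤ {1} {suc m} (ℕ.s≤s ℕ.z≤n)
  M-pos : ℚ.Positive M
  M-pos = ℚ.positive (ℚ.<-≤-trans (ℚ.positive⁻¹ 1ℚ) 1≤M)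
  instance
    M-nonZero : ℚ.NonZero M
    M-nonZero = ℚ.pos⇒nonZero M {{M-pos}}
  t = ℚ.1/ M
  Mt≡1 : M ℚ.* t ≡ 1ℚ
  Mt≡1 = ℚ.*-inverseʳ M
  0<t : 0ℚ ℚ.< t
  0<t = ℚ.positive⁻¹ t {{ℚ.1/pos⇒pos M {{M-pos}}}}
  0≤t = ℚ.<⇒≤ 0<t
  *-pos : ∀ {p q} → 0ℚ ℚ.< p → 0ℚ ℚ.< q → 0ℚ ℚ.< p ℚ.* q
  *-pos {p} {q} 0<p 0<q = ℚ.positive⁻¹ (p ℚ.* q) {{ℚ.pos*pos⇒pos p {{ℚ.positive 0<p}} q {{ℚ.positive 0<q}}}}
  scaled : ∀ {p q} → p ℚ.≤ q → p ℚ.* t ℚ.≤ q ℚ.* t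
  scaled = ℚ.*-monoʳ-≤-nonNeg t {{ℚ.nonNegative 0≤t}}
  t≤1 : t ℚ.≤ 1ℚ
  t≤1 = begin
    t           ≡⟨ ℚ.*-identityˡ t ⟨
    1ℚ ℚ.* t    ≤⟨ scaled 1≤M ⟩
    M ℚ.* t     ≡⟨ Mt≡1 ⟩
    1ℚ          ∎

-- With residuals e = a - θv of the eigenvalue equation and f = -sθ - K of the clique
-- equation, the difference of the two sides is
-- 4s²(δ² - e²) + (4(K - sR + f) - 2)v² + (v - 2se)².
eigen-estimate : ∀ s R K θ v a δ →
  s ℚ.* R ℚ.+ 1ℚ ℚ.≤ K → ℚ.∣ a ℚ.- θ ℚ.* v ∣ ℚ.≤ δ → ℚ.∣ s ℚ.* (ℚ.- θ) ℚ.- K ∣ ℚ.≤ ½ →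
  fromℕ 4 ℚ.* s ℚ.* (v ℚ.* (R ℚ.* v ℚ.+ a)) ℚ.+ v ℚ.* v ℚ.≤ fromℕ 4 ℚ.* s ℚ.* s ℚ.* (δ ℚ.* δ)
eigen-estimate s R K θ v a δ gap small-e small-f = begin
  lhs                                           ≡⟨ ℚ.+-identityʳ lhs ⟨
  lhs ℚ.+ 0ℚ                                    ≤⟨ ℚ.+-monoʳ-≤ lhs (ℚ.+-mono-≤ (ℚ.+-mono-≤ part₁ part₂) part₃) ⟩
  lhs ℚ.+ (fromℕ 4 ℚ.* (s ℚ.* s) ℚ.* (δ ℚ.* δ ℚ.- e ℚ.* e)
    ℚ.+ fromℕ 4 ℚ.* (K ℚ.- (s ℚ.* R ℚ.+ 1ℚ) ℚ.+ (½ ℚ.+ f)) ℚ.* (v ℚ.* v)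
    ℚ.+ g ℚ.* g)                                ≡⟨ identity ⟩
  fromℕ 4 ℚ.* s ℚ.* s ℚ.* (δ ℚ.* δ)             ∎
  where
  open ℚ.≤-Reasoning
  e f g lhs : ℚ
  e = a ℚ.- θ ℚ.* v
  f = s ℚ.* (ℚ.- θ) ℚ.- K
  g = v ℚ.- fromℕ 2 ℚ.* s ℚ.* e
  lhs = fromℕ 4 ℚ.* s ℚ.* (v ℚ.* (R ℚ.* v ℚ.+ a)) ℚ.+ v ℚ.* v
  ≤⇒0≤- : ∀ {p q} → p ℚ.≤ q → 0ℚ ℚ.≤ q ℚ.- p
  ≤⇒0≤- {p} {q} p≤q = subst (ℚ._≤ q ℚ.- p) (ℚ.+-inverseʳ p) (ℚ.+-monoˡ-≤ (ℚ.- p) p≤q)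
  -½≤f : 0ℚ ℚ.≤ ½ ℚ.+ f
  -½≤f with ℚ.∣p∣≡p∨∣p∣≡-p f
  ... | inj₁ eq = ℚ.+-mono-≤ (ℚ.nonNegative⁻¹ ½) (ℚ.∣p∣≡p⇒0≤p eq)
  ... | inj₂ eq = subst (0ℚ ℚ.≤_) (solve 1 (λ f → con ½ :- (:- f) := con ½ :+ f) refl f)
    (≤⇒0≤- (subst (ℚ._≤ ½) eq small-f))
    where open ℚS.+-*-Solver
  0≤4 = 0≤fromℕ 4
  part₁ : 0ℚ ℚ.≤ fromℕ 4 ℚ.* (s ℚ.* s) ℚ.* (δ ℚ.* δ ℚ.- e ℚ.* e)
  part₁ = *-nonNeg (*-nonNeg 0≤4 (square-nonNeg s)) (≤⇒0≤- (∣∣≤⇒square≤ small-e))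
  part₂ : 0ℚ ℚ.≤ fromℕ 4 ℚ.* (K ℚ.- (s ℚ.* R ℚ.+ 1ℚ) ℚ.+ (½ ℚ.+ f)) ℚ.* (v ℚ.* v)
  part₂ = *-nonNeg (*-nonNeg 0≤4 (ℚ.+-mono-≤ (≤⇒0≤- gap) -½≤f)) (square-nonNeg v)
  part₃ : 0ℚ ℚ.≤ g ℚ.* g
  part₃ = square-nonNeg g
  identity : lhs ℚ.+ (fromℕ 4 ℚ.* (s ℚ.* s) ℚ.* (δ ℚ.* δ ℚ.- e ℚ.* e)
    ℚ.+ fromℕ 4 ℚ.* (K ℚ.- (s ℚ.* R ℚ.+ 1ℚ) ℚ.+ (½ ℚ.+ f)) ℚ.* (v ℚ.* v)
    ℚ.+ g ℚ.* g) ≡ fromℕ 4 ℚ.* s ℚ.* s ℚ.* (δ ℚ.* δ)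
  identity = solve 7 (λ s R K θ v a δ →
    let e = a :- θ :* v ; f = s :* (:- θ) :- K ; g = v :- con (fromℕ 2) :* s :* e
    in (con (fromℕ 4) :* s :* (v :* (R :* v :+ a)) :+ v :* v) :+ (con (fromℕ 4) :* (s :* s) :* (δ :* δ :- e :* e)
      :+ con (fromℕ 4) :* (K :- (s :* R :+ con 1ℚ) :+ (con ½ :+ f)) :* (v :* v)
      :+ g :* g) := con (fromℕ 4) :* s :* s :* (δ :* δ)) refl s R K θ v a δ
    where open ℚS.+-*-Solver

module _ {n} (Γ : FiniteGraph n) where

  Form : ℕ → (Fin n → ℚ) → ℚ
  Form r v = sum (λ x → v x ℚ.* (fromℕ r ℚ.* v x ℚ.+ sum (λ w → adjacency Γ x w ℚ.* v w)))

  -- From s(-θ) = K > sr it would follow that θ < -r, against semidefiniteness of A + rI. As reals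
  -- are Cauchy sequences, the contradiction is found at a single index `p`: there one coordinate
  -- exceeds ε in absolute value, while summing `eigen-estimate` bounds the sum of all squares by
  -- ε².
  eigenvalue-bound : ∀ {r K} → (∀ v → 0ℚ ℚ.≤ Form r v) → ∀ s → s ℕ.* r ℕ.+ 1 ℕ.≤ K →
    ∀ θ → Eigenvalue Γ θ → ¬ (λ p → fromℕ s ℚ.* (ℚ.- seq θ p)) ≃ (λ _ → fromℕ K)
  eigenvalue-bound {r} {K} psd s gap θ (v , (x₀ , ε , 0<ε , N₀ , apart) , eigen) size =
    ℚ.<-irrefl refl (begin-strict
      ε ℚ.* ε                                      <⟨ square-< ⟩
      u x₀ ℚ.* u x₀                                ≤⟨ sum-≥ (λ x → u x ℚ.* u x) (square-nonNeg ∘ u) x₀ ⟩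
      sum (λ x → u x ℚ.* u x)                      ≡⟨ ℚ.+-identityˡ _ ⟨
      0ℚ ℚ.+ sum (λ x → u x ℚ.* u x)               ≤⟨ ℚ.+-monoˡ-≤ (sum (λ x → u x ℚ.* u x))
                                                      (*-nonNeg (*-nonNeg (0≤fromℕ 4) (0≤fromℕ s)) (psd u)) ⟩
      4s ℚ.* Form r u ℚ.+ sum (λ x → u x ℚ.* u x)  ≡⟨ cong (ℚ._+ sum (λ x → u x ℚ.* u x)) (*-distribˡ-sum 4s term) ⟩
      sum (λ x → 4s ℚ.* term x) ℚ.+ sum (λ x → u x ℚ.* u x)
                                                   ≡⟨ ∑-distrib-+ (λ x → 4s ℚ.* term x) (λ x → u x ℚ.* u x) ⟨
      sum (λ x → 4s ℚ.* term x ℚ.+ u x ℚ.* u x)    ≤⟨ sum-mono-≤ (λ x → 4s ℚ.* term x ℚ.+ u x ℚ.* u x) (λ _ → bound)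
                                                      (λ x → eigen-estimate (fromℕ s) (fromℕ r) (fromℕ K) (seq θ p) (u x)
                                                        (sum (λ w → adjacency Γ x w ℚ.* u w)) δ gap′
                                                        (ℚ.<⇒≤ (proj₂ eig p N₁≤p x)) (ℚ.<⇒≤ (proj₂ siz p N₂≤p))) ⟩
      sum {n} (λ _ → bound)                        ≡⟨ sum-const n bound ⟩
      fromℕ n ℚ.* bound                            ≡⟨ collect ⟩
      fromℕ m ℚ.* (δ ℚ.* δ)                        ≤⟨ proj₂ (proj₂ small) ⟩
      ε ℚ.* ε                                      ∎)
    where
    open ℚ.≤-Reasoning
    -- Each of the n coordinates contributes an error of at most 4s²δ², so δ must satisfy 4ns²δ² ≤
    -- ε².
    m = n ℕ.* (4 ℕ.* s ℕ.* s)
    small = square-small m 0<ε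
    δ = proj₁ small
    eig = eventually-∀ (λ x → eigen x δ (proj₁ (proj₂ small)))
    siz = size ½ (ℚ.positive⁻¹ ½)
    p = N₀ ℕ.+ (proj₁ eig ℕ.+ proj₁ siz)
    N₁≤p : proj₁ eig ℕ.≤ p
    N₁≤p = ℕ.≤-trans (ℕ.m≤m+n (proj₁ eig) (proj₁ siz)) (ℕ.m≤n+m _ N₀)
    N₂≤p : proj₁ siz ℕ.≤ p
    N₂≤p = ℕ.≤-trans (ℕ.m≤n+m (proj₁ siz) (proj₁ eig)) (ℕ.m≤n+m _ N₀)
    u : Fin n → ℚ
    u x = seq (v x) p
    4s bound : ℚ
    4s = fromℕ 4 ℚ.* fromℕ s
    bound = fromℕ 4 ℚ.* fromℕ s ℚ.* fromℕ s ℚ.* (δ ℚ.* δ)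
    term : Fin n → ℚ
    term x = u x ℚ.* (fromℕ r ℚ.* u x ℚ.+ sum (λ w → adjacency Γ x w ℚ.* u w))
    gap′ : fromℕ s ℚ.* fromℕ r ℚ.+ 1ℚ ℚ.≤ fromℕ K
    gap′ = subst (ℚ._≤ fromℕ K) (trans (fromℕ-+ (s ℕ.* r) 1) (cong (ℚ._+ 1ℚ) (fromℕ-* s r))) (fromℕ-mono-≤ gap)
    square-< : ε ℚ.* ε ℚ.< u x₀ ℚ.* u x₀
    square-< = begin-strict
      ε ℚ.* ε                          <⟨ ℚ.*-monoʳ-<-pos ε {{ℚ.positive 0<ε}} ε<∣u∣ ⟩
      ε ℚ.* ℚ.∣ u x₀ ∣                 ≤⟨ ℚ.*-monoʳ-≤-nonNeg ℚ.∣ u x₀ ∣ {{ℚ.nonNegative (ℚ.0≤∣p∣ (u x₀))}} (ℚ.<⇒≤ ε<∣u∣) ⟩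
      ℚ.∣ u x₀ ∣ ℚ.* ℚ.∣ u x₀ ∣        ≡⟨ ℚ.∣p*q∣≡∣p∣*∣q∣ (u x₀) (u x₀) ⟨
      ℚ.∣ u x₀ ℚ.* u x₀ ∣              ≡⟨ ℚ.0≤p⇒∣p∣≡p (square-nonNeg (u x₀)) ⟩
      u x₀ ℚ.* u x₀                    ∎
      where
      ε<∣u∣ = apart p (ℕ.m≤m+n N₀ _)
    sum-≥ : ∀ {n} (f : Fin n → ℚ) → (∀ i → 0ℚ ℚ.≤ f i) → ∀ i → f i ℚ.≤ sum f
    sum-≥ f 0≤f zero    = subst (ℚ._≤ sum f) (ℚ.+-identityʳ (f zero))
      (ℚ.+-monoʳ-≤ (f zero) (sum-nonNeg (f ∘ suc) (0≤f ∘ suc)))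
    sum-≥ f 0≤f (suc i) = subst (ℚ._≤ sum f) (ℚ.+-identityˡ (f (suc i)))
      (ℚ.+-mono-≤ (0≤f zero) (sum-≥ (f ∘ suc) (0≤f ∘ suc) i))
    collect : fromℕ n ℚ.* bound ≡ fromℕ m ℚ.* (δ ℚ.* δ)
    collect = trans (sym (ℚ.*-assoc (fromℕ n) (4s ℚ.* fromℕ s) (δ ℚ.* δ))) (cong (ℚ._* (δ ℚ.* δ))
      (sym (trans (fromℕ-* n (4 ℕ.* s ℕ.* s)) (cong (fromℕ n ℚ.*_)
        (trans (fromℕ-* (4 ℕ.* s) s) (cong (ℚ._* fromℕ s) (fromℕ-* 4 s)))))))

-- Divisibility for 2-designs

module _ {m} {X : Set} (_≟ˣ_ : DecidableEquality X) (f : Fin m → X) (p : Subset m) where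

  private
    class? : ∀ x i → Dec (f i ≡ x)
    class? x i = f i ≟ˣ x

    pick : Fin m → ∀ {x} → Dec (∃[ i ] f i ≡ x) → Fin m
    pick i (yes (j , _)) = j
    -- This default never arises for `rep`, as `i` lies in its own class.
    pick i (no _)        = i

    -- `∣p∣-fibres` takes parts indexed by `Fin`, while `f` has values in an arbitrary type, so a
    -- class is named by an index in it. The search depends only on the value `f i`, hence a whole
    -- class gets the same name.
    rep : Fin m → Fin m
    rep i = pick i (any? (class? (f i)))

    f-rep : ∀ i → f (rep i) ≡ f i
    f-rep i with any? (class? (f i))
    ... | yes (_ , eq) = eq
    ... | no ∄         = contradiction (i , refl) ∄

    rep-cong : ∀ {i j} → f i ≡ f j → rep i ≡ rep j
    rep-cong {i} {j} eq rewrite eq with any? (class? (f j))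
    ... | yes _ = refl
    ... | no ∄  = contradiction (j , refl) ∄

  class-size-∣ : ∀ k → (∀ {i} → i ∈ p → ∣ p ∩ fromDec (class? (f i)) ∣ ≡ k) → k ∣ ∣ p ∣
  class-size-∣ k size = subst (k ∣_)
    (sym (∣p∣-fibres p F k (λ {i} _ → rep i , ∈-fromDec⁺ (F? (rep i)) refl)
      (λ {_} {d} {d′} _ q q′ → trans (sym (∈-fromDec⁻ (F? d) q)) (∈-fromDec⁻ (F? d′) q′)) fibre))
    (n∣m*n ∣ support p F ∣)
    where
    F? : ∀ t i → Dec (rep i ≡ t)
    F? t i = rep i ≟ t
    F : Fin m → Subset m
    F t = fromDec (F? t)
    fibre : ∀ {i t} → i ∈ p → i ∈ F t → ∣ p ∩ F t ∣ ≡ k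
    fibre {i} {t} i∈p i∈F with ∈-fromDec⁻ (F? t) i∈F
    ... | refl = trans (cong (λ q → ∣ p ∩ q ∣) (⊆-antisym
      (λ {j} j∈ → ∈-fromDec⁺ (class? (f i))
        (trans (sym (f-rep j)) (trans (cong f (∈-fromDec⁻ (F? (rep i)) j∈)) (f-rep i))))
      (λ {j} j∈ → ∈-fromDec⁺ (F? (rep i)) (rep-cong (∈-fromDec⁻ (class? (f i)) j∈))))) (size i∈p)

module _ {n : ℕ} where

  Pair : Subset n → Pred (Fin n × Fin n) 0ℓ
  Pair p (x , y) = x ∈ p × y ∈ p × x ≢ y

  pair? : ∀ p i → Dec (Pair p (remQuot n i))
  pair? p i = let x , y = remQuot n i in (x ∈? p) ×-dec (y ∈? p) ×-dec ¬? (x ≟ y)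

  -- Ordered pairs of distinct points are coded in `Fin (n * n)`, so that a set of pairs is again a
  -- `Subset` with a cardinality.
  pairs : Subset n → Subset (n * n)
  pairs p = fromDec (pair? p)

  ∣pairs∣ : ∀ {k} (p : Subset n) → ∣ p ∣ ≡ suc k → ∣ pairs p ∣ ≡ suc k * k
  ∣pairs∣ {k} p ∣p∣≡ = ∣p∣≡-by (pairs p) Fin.*↔× e inj snd cmp
    where
    G = subst (λ m → ∃[ g ] Enumerates {m = m} p g) ∣p∣≡ (enumerate p)
    g = proj₁ G
    e : Fin (suc k) × Fin k → Fin (n * n)
    e (a , c) = combine (g a) (g (punchIn a c))
    inj : ∀ {i i′} → e i ≡ e i′ → i ≡ i′
    inj {a , c} {a′ , c′} eq with Fin.combine-injective (g a) (g (punchIn a c)) (g a′) (g (punchIn a′ c′)) eq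
    ... | eq₁ , eq₂ with injective (proj₂ G) eq₁
    ... | refl = cong (a ,_) (Fin.punchIn-injective a c c′ (injective (proj₂ G) eq₂))
    snd : ∀ i → e i ∈ pairs p
    snd (a , c) = ∈-fromDec⁺ (pair? p) (subst (Pair p) (sym (Fin.remQuot-combine (g a) (g (punchIn a c))))
      (sound (proj₂ G) a , sound (proj₂ G) _ , λ eq → Fin.punchInᵢ≢i a c (sym (injective (proj₂ G) eq))))
    cmp : ∀ {i} → i ∈ pairs p → ∃[ t ] e t ≡ i
    cmp {i} i∈ with ∈-fromDec⁻ (pair? p) i∈
    ... | x∈ , y∈ , x≢y with complete (proj₂ G) x∈ | complete (proj₂ G) y∈
    ... | a , ga≡ | c , gc≡ = (a , punchOut a≢c) , (begin
        combine (g a) (g (punchIn a (punchOut a≢c)))  ≡⟨ cong (combine (g a) ∘ g) (Fin.punchIn-punchOut a≢c) ⟩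
        combine (g a) (g c)                           ≡⟨ cong₂ combine ga≡ gc≡ ⟩
        uncurry combine (remQuot {n} n i)             ≡⟨ Fin.combine-remQuot {n} n i ⟩
        i                                             ∎)
      where
      open ≡-Reasoning
      a≢c : a ≢ c
      a≢c refl = x≢y (trans (sym ga≡) gc≡)

  ∣⁅x⁆∪⁅y⁆∣ : ∀ {x y : Fin n} → x ≢ y → ∣ ⁅ x ⁆ ∪ ⁅ y ⁆ ∣ ≡ 2
  ∣⁅x⁆∪⁅y⁆∣ {x} {y} x≢y = ∣p∣≡suc-by (⁅ x ⁆ ∪ ⁅ y ⁆) Fin.1↔⊤ x (λ _ → y)
    (λ _ → refl) (λ _ → ≢-sym x≢y) (x∈p∪q⁺ (inj₁ (x∈⁅x⁆ x))) (λ _ → x∈p∪q⁺ (inj₂ (x∈⁅x⁆ y))) cover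
    where
    cover : ∀ {z} → z ∈ ⁅ x ⁆ ∪ ⁅ y ⁆ → z ≡ x ⊎ ∃[ _ ] y ≡ z
    cover z∈ with x∈p∪q⁻ ⁅ x ⁆ ⁅ y ⁆ z∈
    ... | inj₁ z∈x = inj₁ (x∈⁅y⁆⇒x≡y x z∈x)
    ... | inj₂ z∈y = inj₂ (_ , sym (x∈⁅y⁆⇒x≡y y z∈y))

  ⁅x⁆∪⁅y⁆⊆ : ∀ {x y : Fin n} {p} → x ∈ p → y ∈ p → ⁅ x ⁆ ∪ ⁅ y ⁆ ⊆ p
  ⁅x⁆∪⁅y⁆⊆ {x} {y} x∈p y∈p z∈ with x∈p∪q⁻ ⁅ x ⁆ ⁅ y ⁆ z∈
  ... | inj₁ z∈x rewrite x∈⁅y⁆⇒x≡y x z∈x = x∈p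
  ... | inj₂ z∈y rewrite x∈⁅y⁆⇒x≡y y z∈y = y∈p

  module _ {v k} {𝒫 : Subset n} {ℬ : Pred (Subset n) 0ℓ} (design : IsDesign 2 (suc v) (suc k) 1 𝒫 ℬ) where
    open IsDesign design

    private
      block : ∀ {x y} → Pair 𝒫 (x , y) →
        ∃[ S ] (ℬ S × x ∈ S × y ∈ S × (∀ S′ → ℬ S′ → x ∈ S′ → y ∈ S′ → S′ ≡ S))
      block {x} {y} (x∈ , y∈ , x≢y)
        with balance (⁅ x ⁆ ∪ ⁅ y ⁆) (⁅x⁆∪⁅y⁆⊆ x∈ y∈) (∣⁅x⁆∪⁅y⁆∣ x≢y)
      ... | S ∷ [] , _ , refl , members =
        let S∈ℬ , T⊆S = Equivalence.to (members S) (here refl) in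
        S , S∈ℬ , T⊆S (x∈p∪q⁺ (inj₁ (x∈⁅x⁆ x))) , T⊆S (x∈p∪q⁺ (inj₂ (x∈⁅x⁆ y))) ,
        λ S′ S′∈ℬ x∈S′ y∈S′ → single (Equivalence.from (members S′) (S′∈ℬ , ⁅x⁆∪⁅y⁆⊆ x∈S′ y∈S′))
        where
        single : ∀ {S′} → S′ ∈ˡ S ∷ [] → S′ ≡ S
        single (here eq) = eq

      blk : Fin (n * n) → Subset n
      blk i with pair? 𝒫 i
      ... | yes P = proj₁ (block P)
      -- A junk value: blocks are compared only for codes in `pairs 𝒫`.
      ... | no _  = ∅

      blk-spec : ∀ i → Pair 𝒫 (remQuot n i) → let x , y = remQuot n i in
        ℬ (blk i) × x ∈ blk i × y ∈ blk i × (∀ S → ℬ S → x ∈ S → y ∈ S → S ≡ blk i)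
      blk-spec i P with pair? 𝒫 i
      ... | yes P′ = proj₂ (block P′)
      ... | no ¬P  = contradiction P ¬P

      _≟ˢ_ : DecidableEquality (Subset n)
      _≟ˢ_ = ≡-dec _≟ᵇ_

    -- Sort the ordered pairs of distinct points by the unique block through them. A block that
    -- occurs accounts for all (k + 1)k ordered pairs of its own points.
    design-∣ : suc k * k ∣ suc v * v
    design-∣ = subst (suc k * k ∣_) (∣pairs∣ 𝒫 points)
      (class-size-∣ _≟ˢ_ blk (pairs 𝒫) (suc k * k) same-block)
      where
      same-block : ∀ {i} → i ∈ pairs 𝒫 → ∣ pairs 𝒫 ∩ fromDec (λ j → blk j ≟ˢ blk i) ∣ ≡ suc k * k
      same-block {i} i∈ with blk-spec i (∈-fromDec⁻ (pair? 𝒫) i∈)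
      ... | S∈ℬ , _ with blocks (blk i) S∈ℬ
      ... | S⊆𝒫 , ∣S∣ = trans (cong ∣_∣ (⊆-antisym into from)) (∣pairs∣ (blk i) ∣S∣)
        where
        into : pairs 𝒫 ∩ fromDec (λ j → blk j ≟ˢ blk i) ⊆ pairs (blk i)
        into {j} j∈ with x∈p∩q⁻ (pairs 𝒫) (fromDec (λ j → blk j ≟ˢ blk i)) j∈
        ... | j∈pairs , j∈class with ∈-fromDec⁻ (pair? 𝒫) j∈pairs
        ... | P@(_ , _ , x≢y) with blk-spec j P
        ... | _ , x∈ , y∈ , _ = ∈-fromDec⁺ (pair? (blk i)) (subst (_ ∈_) eq x∈ , subst (_ ∈_) eq y∈ , x≢y)
          where eq = ∈-fromDec⁻ (λ j → blk j ≟ˢ blk i) j∈class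
        from : pairs (blk i) ⊆ pairs 𝒫 ∩ fromDec (λ j → blk j ≟ˢ blk i)
        from {j} j∈ with ∈-fromDec⁻ (pair? (blk i)) j∈
        ... | x∈ , y∈ , x≢y = x∈p∩q⁺ (∈-fromDec⁺ (pair? 𝒫) P ,
          ∈-fromDec⁺ (λ j → blk j ≟ˢ blk i) (sym (proj₂ (proj₂ (proj₂ (blk-spec j P))) (blk i) S∈ℬ x∈ y∈)))
          where P = S⊆𝒫 x∈ , S⊆𝒫 y∈ , x≢y

-- Parameters

local-grid : ∀ {n} (Γ : FiniteGraph n) {A r α} x →
  localGraph Γ x ≅ cliqueExtension α (grid A r) → LocalGrid Γ A r α x
local-grid Γ {A} {r} {α} x (φ , adj) = record
  { pt     = λ a j i → proj₁ (from ((a , j) , i))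
  ; pt-nbr = λ {a} {j} {i} → ∈S₁⇒~ (proj₂ (from ((a , j) , i)))
  ; loc    = λ {z} x~z → let u = z , ~⇒∈S₁ x~z ; (a , j) , i = to u in
               a , j , i , cong proj₁ (strictlyInverseʳ u)
  ; pt-inj = λ eq → coordinates (trans (sym (strictlyInverseˡ _))
               (trans (cong to (∈-ext eq)) (strictlyInverseˡ _)))
  ; ~⇒≡    = λ p~q → share (subst₂ H._~_ (strictlyInverseˡ _) (strictlyInverseˡ _)
               (Equivalence.to (adj _ _) p~q))
  ; row-~  = row
  ; col-~  = col
  }
  where
  open FiniteGraph Γ
  open Neighbours Γ
  open Inverse φ
  module H = Graph (cliqueExtension α (grid A r))
  -- Membership proofs are unique, so equality in the local graph can be tested in Γ.
  ∈-ext : ∀ {u v : ∃ (_∈ sphere Γ 1 x)} → proj₁ u ≡ proj₁ v → u ≡ v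
  ∈-ext {_ , p} {_ , q} refl = cong (_ ,_) ([]=-irrelevant p q)
  coordinates : ∀ {a j i a′ j′ i′} → ((a , j) , i) ≡ ((a′ , j′) , i′) → a ≡ a′ × j ≡ j′ × i ≡ i′
  coordinates refl = refl , refl , refl
  share : ∀ {a j i a′ j′ i′} → ((a , j) , i) H.~ ((a′ , j′) , i′) → a ≡ a′ ⊎ j ≡ j′
  share (inj₁ (refl , _))        = inj₁ refl
  share (inj₂ (inj₁ (a≡a′ , _))) = inj₁ a≡a′
  share (inj₂ (inj₂ (_ , j≡j′))) = inj₂ j≡j′
  adjacent : ∀ {s t} → s H.~ t → proj₁ (from s) ~ proj₁ (from t)
  adjacent {s} {t} s~t = Equivalence.from (adj (from s) (from t))
    (subst₂ H._~_ (sym (strictlyInverseˡ s)) (sym (strictlyInverseˡ t)) s~t)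
  row : ∀ {a j i j′ i′} → proj₁ (from ((a , j) , i)) ≢ proj₁ (from ((a , j′) , i′)) →
        proj₁ (from ((a , j) , i)) ~ proj₁ (from ((a , j′) , i′))
  row {j = j} {j′ = j′} p≢q with j ≟ j′
  ... | yes refl = adjacent (inj₁ (refl , λ { refl → p≢q refl }))
  ... | no j≢j′  = adjacent (inj₂ (inj₁ (refl , j≢j′)))
  col : ∀ {a j i a′ i′} → proj₁ (from ((a , j) , i)) ≢ proj₁ (from ((a′ , j) , i′)) →
        proj₁ (from ((a , j) , i)) ~ proj₁ (from ((a′ , j) , i′))
  col {a = a} {a′ = a′} p≢q with a ≟ a′
  ... | yes refl = adjacent (inj₁ (refl , λ { refl → p≢q refl }))
  ... | no a≢a′  = adjacent (inj₂ (inj₂ (a≢a′ , refl)))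

-- In this module `b` is the classical parameter minus two. Thus the divisor in `bracket` is the
-- successor `suc b`, and the number [2] is `3 + b`.
module Parameters {n} {Γ : FiniteGraph n} (dr : DistanceRegular Γ) {D b α β : ℕ}
  (params : ClassicalParameters dr D (+ suc (suc b)) (fromℕ α) (fromℕ β))
  {r : ℕ} (r≡[D] : + r ≡ bracket (+ suc (suc b)) D) where
  open ClassicalParameters params
  module dr = DistanceRegular dr

  [_] : ℕ → ℤ
  [ j ] = bracket (+ suc (suc b)) j

  [1]≡1 : [ 1 ] ≡ + 1
  [1]≡1 = trans (div-pos-is-/ℕ (+ (suc (suc b) * 1 ∸ 1)) (suc b)) (cong +_ (trans (cong (λ m → m ℕ./ suc b) (ℕ.*-identityʳ (suc b))) (ℕ.n/n≡1 (suc b))))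

  [2]≡b+1 : [ 2 ] ≡ + suc (suc (suc b))
  [2]≡b+1 = trans (div-pos-is-/ℕ (+ (suc (suc b) * (suc (suc b) * 1) ∸ 1)) (suc b)) (cong +_ (trans (cong (λ m → m ℕ./ suc b) eq) (ℕ.m*n/n≡m (suc (suc (suc b))) (suc b))))
    where
    -- With q = b + 2 this is q² - 1 = (q + 1)(q - 1).
    eq : suc (suc b) * (suc (suc b) * 1) ∸ 1 ≡ suc (suc (suc b)) * suc b
    eq = trans (cong (λ m → suc (suc b) * m ∸ 1) (ℕ.*-identityʳ (suc (suc b))))
      (cong (λ m → suc b ℕ.+ m) (ℕ.*-comm (suc b) (suc (suc b))))

  b-eq-ℤ : ∀ i → i ≤ D → + dr.b i ≡ (+ r ℤ.- [ i ]) ℤ.* (+ β ℤ.- + α ℤ.* [ i ])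
  b-eq-ℤ i i≤D = fromℤ-injective (begin
    fromℕ (dr.b i)
      ≡⟨ b-eq i i≤D ⟩
    (fromℤ [ D ] ℚ.- fromℤ [ i ]) ℚ.* (fromℕ β ℚ.- fromℕ α ℚ.* fromℤ [ i ])
      ≡⟨ cong₂ ℚ._*_ (trans (cong (λ z → fromℤ z ℚ.- fromℤ [ i ]) (sym r≡[D])) (sym (fromℤ-sub (+ r) [ i ])))
                     (trans (cong (λ q → fromℕ β ℚ.- q) (sym (fromℤ-* (+ α) [ i ])))
                            (sym (fromℤ-sub (+ β) (+ α ℤ.* [ i ])))) ⟩
    fromℤ (+ r ℤ.- [ i ]) ℚ.* fromℤ (+ β ℤ.- + α ℤ.* [ i ])
      ≡⟨ fromℤ-* (+ r ℤ.- [ i ]) (+ β ℤ.- + α ℤ.* [ i ]) ⟨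
    fromℤ ((+ r ℤ.- [ i ]) ℤ.* (+ β ℤ.- + α ℤ.* [ i ]))
      ∎)
    where open ≡-Reasoning

  minus : ∀ {m n} → n ≤ m → + m ℤ.- + n ≡ + (m ∸ n)
  minus {m} {n} n≤m = trans (ℤ.m-n≡m⊖n m n) (ℤ.⊖-≥ n≤m)

  b-eq-ℕ : ∀ i j → i ≤ D → [ i ] ≡ + j → j ≤ r → α * j ≤ β → dr.b i ≡ (r ∸ j) * (β ∸ α * j)
  b-eq-ℕ i j i≤D [i]≡j j≤r αj≤β = ℤ.+-injective (begin
    + dr.b i                                          ≡⟨ b-eq-ℤ i i≤D ⟩
    (+ r ℤ.- [ i ]) ℤ.* (+ β ℤ.- + α ℤ.* [ i ])       ≡⟨ cong (λ z → (+ r ℤ.- z) ℤ.* (+ β ℤ.- + α ℤ.* z)) [i]≡j ⟩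
    (+ r ℤ.- + j) ℤ.* (+ β ℤ.- + α ℤ.* + j)           ≡⟨ cong (λ z → (+ r ℤ.- + j) ℤ.* (+ β ℤ.- z)) (ℤ.pos-* α j) ⟨
    (+ r ℤ.- + j) ℤ.* (+ β ℤ.- + (α * j))             ≡⟨ cong₂ ℤ._*_ (minus j≤r) (minus αj≤β) ⟩
    + (r ∸ j) ℤ.* + (β ∸ α * j)                       ≡⟨ ℤ.pos-* (r ∸ j) (β ∸ α * j) ⟨
    + ((r ∸ j) * (β ∸ α * j))                         ∎)
    where open ≡-Reasoning

  valency≡ : dr.valency ≡ r * β
  valency≡ = trans (b-eq-ℕ 0 0 z≤n refl z≤n (subst (_≤ β) (sym (ℕ.*-zeroʳ α)) z≤n))
    (cong (λ m → r * (β ∸ m)) (ℕ.*-zeroʳ α))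

  c₂≡ : 1 < D → dr.c 2 ≡ suc (suc (suc b)) * suc α
  c₂≡ 1<D = ℤ.+-injective (fromℤ-injective (begin
    fromℕ (dr.c 2)
      ≡⟨ c-eq 1 1<D ⟩
    fromℤ [ 2 ] ℚ.* (1ℚ ℚ.+ fromℕ α ℚ.* fromℤ [ 1 ])
      ≡⟨ cong₂ (λ y z → fromℤ y ℚ.* (1ℚ ℚ.+ fromℕ α ℚ.* fromℤ z)) [2]≡b+1 [1]≡1 ⟩
    fromℕ (3 + b) ℚ.* (1ℚ ℚ.+ fromℕ α ℚ.* 1ℚ)
      ≡⟨ cong (λ q → fromℕ (3 + b) ℚ.* (1ℚ ℚ.+ q)) (ℚ.*-identityʳ (fromℕ α)) ⟩
    fromℕ (3 + b) ℚ.* (1ℚ ℚ.+ fromℕ α)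
      ≡⟨ cong (fromℕ (3 + b) ℚ.*_) (fromℕ-+ 1 α) ⟨
    fromℕ (3 + b) ℚ.* fromℕ (suc α)
      ≡⟨ fromℕ-* (3 + b) (suc α) ⟨
    fromℕ ((3 + b) * suc α)
      ∎))
    where open ≡-Reasoning

  -- As β = Aα, the factor β - α[2] equals (A - [2])α. This puts b₂ in the form of the number of
  -- points of a local grid that avoid [2] rows and [2] columns.
  b₂≡ : ∀ {A} → A * α ≡ β → 2 ≤ D → 3 + b ≤ r → 3 + b ≤ A →
        dr.b 2 ≡ (A ∸ (3 + b)) * ((r ∸ (3 + b)) * α)
  b₂≡ {A} refl 2≤D j≤r j≤A = begin
    dr.b 2                              ≡⟨ b-eq-ℕ 2 j 2≤D [2]≡b+1 j≤r (subst (_≤ A * α) (ℕ.*-comm j α) (ℕ.*-monoˡ-≤ α j≤A)) ⟩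
    (r ∸ j) * (A * α ∸ α * j)           ≡⟨ cong (λ m → (r ∸ j) * (A * α ∸ m)) (ℕ.*-comm α j) ⟩
    (r ∸ j) * (A * α ∸ j * α)           ≡⟨ cong ((r ∸ j) *_) (ℕ.*-distribʳ-∸ α A j) ⟨
    (r ∸ j) * ((A ∸ j) * α)             ≡⟨ ℕ.*-assoc (r ∸ j) (A ∸ j) α ⟨
    (r ∸ j) * (A ∸ j) * α               ≡⟨ cong (_* α) (ℕ.*-comm (r ∸ j) (A ∸ j)) ⟩
    (A ∸ j) * (r ∸ j) * α               ≡⟨ ℕ.*-assoc (A ∸ j) (r ∸ j) α ⟩
    (A ∸ j) * ((r ∸ j) * α)             ∎
    where
    open ≡-Reasoning
    j = 3 + b

-- Lines and assemblies

two-elements : ∀ {n} {p : Subset n} → 2 ≤ ∣ p ∣ → ∃₂ λ x y → x ∈ p × y ∈ p × x ≢ y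
two-elements {p = p} 2≤ with ∣ p ∣ | enumerate p
two-elements (s≤s (s≤s _)) | _ | e , E =
  e zero , e (suc zero) , sound E zero , sound E (suc zero) , λ eq → contradiction (injective E eq) λ ()

module Lines {n} (Γ : FiniteGraph n) (dr : DistanceRegular Γ) {A r α : ℕ}
  (local : ∀ x → LocalGrid Γ A r α x) (rows<cols : α * r < A * α)
  (valency≡ : DistanceRegular.valency dr ≡ r * (A * α))
  (𝒞 : Pred (Subset n) 0ℓ) (geometric : Geometric Γ dr 𝒞) where

  open FiniteGraph Γ
  open LocallyGrid Γ local rows<cols

  open LineSpace Γ Col centre∈Col ∣Col∣ Col-nbr
    nbr∈Col Col-unique Col-sym using (form-nonNeg)

  -- If s = `∣ C ∣` - 1 were less than β, the Delsarte equation s(-θ) = rβ would put the smallest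
  -- eigenvalue below -r.
  line-size : ∀ {C x a j i} → 𝒞 C → x ∈ C → pt x a j i ∈ C → suc (A * α) ≤ ∣ C ∣
  line-size {C} {x} {a} {j} C∈𝒞 x∈C pt∈C with ∣ C ∣ in eq | proj₁ geometric C C∈𝒞
  ... | zero  | _ = contradiction (ℕ.≤-trans (ℕ.≤-reflexive (sym (∣⁅x⁆∣≡1 x)))
                      (ℕ.≤-trans (p⊆q⇒∣p∣≤∣q∣ λ u∈ → subst (_∈ C) (sym (x∈⁅y⁆⇒x≡y x u∈)) x∈C) (ℕ.≤-reflexive eq))) λ ()
  ... | suc s | _ , θ , (eigen , _) , delsarte = s≤s (ℕ.≮⇒≥ λ s<β →
    eigenvalue-bound Γ form-nonNeg s (gap s<β) θ eigen
      (subst₂ (λ q k → (λ p → q ℚ.* (ℚ.- seq θ p)) ≃ (λ _ → fromℕ k)) suc-1 valency≡ delsarte))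
    where
    suc-1 : fromℕ (suc s) ℚ.- 1ℚ ≡ fromℕ s
    suc-1 = trans (cong (ℚ._- 1ℚ) (fromℕ-+ 1 s)) (solve 1 (λ q → con 1ℚ :+ q :- con 1ℚ := q) refl (fromℕ s))
      where open ℚS.+-*-Solver
    -- The column index `j` witnesses r ≥ 1, which makes sr < rβ strict.
    gap : s < A * α → s * r + 1 ≤ r * (A * α)
    gap s<β = begin
      s * r + 1    ≡⟨ ℕ.+-comm (s * r) 1 ⟩
      1 + s * r    ≤⟨ ℕ.+-monoˡ-≤ (s * r) (ℕ.≤-trans (s≤s z≤n) (Fin.toℕ<n j)) ⟩
      r + s * r    ≤⟨ ℕ.*-monoˡ-≤ r s<β ⟩
      A * α * r    ≡⟨ ℕ.*-comm (A * α) r ⟩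
      r * (A * α)  ∎
      where open ℕ.≤-Reasoning

  line≡Col : ∀ {C x a j i} → 𝒞 C → x ∈ C → pt x a j i ∈ C → C ≡ Col x j
  line≡Col {C} C∈𝒞 x∈C pt∈C =
    big-clique (proj₁ (proj₁ geometric C C∈𝒞)) (line-size C∈𝒞 x∈C pt∈C) x∈C pt∈C

  -- The last two arguments pick a point of the column other than `x`; the line through this edge
  -- must be the column.
  Col∈𝒞 : ∀ x j → Fin A → Fin α → 𝒞 (Col x j)
  Col∈𝒞 x j a i with proj₂ geometric x (pt x a j i) pt-nbr
  ... | C , (C∈𝒞 , x∈C , pt∈C) , _ = subst 𝒞 (line≡Col C∈𝒞 x∈C pt∈C) C∈𝒞

  -- By maximality, an assembly inside a column would equal it and be a line, so only a row remains.
  assembly≡Row : ∀ {M y w} → Assembly Γ 𝒞 M → y ∈ M → y ~ w → ∃[ a ] M ≡ Row y a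
  assembly≡Row {M} {y} ((clique , maximal) , M∉𝒞) y∈M y~w
    with any? (λ u → (u ∈? M) ×-dec ¬? (u ≟ y))
  ... | yes (u , u∈M , u≢y) with loc (clique y∈M u∈M (≢-sym u≢y))
  ...   | a , j , i , refl with clique⊆Col⊎Row clique y∈M u∈M
  ...     | inj₁ M⊆Col = contradiction (subst 𝒞 (maximal _ (Col-clique y j) M⊆Col) (Col∈𝒞 y j a i)) M∉𝒞
  ...     | inj₂ M⊆Row = a , sym (maximal _ (Row-clique y a) M⊆Row)
  -- If `y` is the only point of `M`, then `M` is contained in every row at `y`; the neighbour `w`
  -- provides one.
  assembly≡Row {M} {y} ((clique , maximal) , M∉𝒞) y∈M y~w
      | no ∄ with loc y~w
  ...   | a , j , i , _ = a , sym (maximal _ (Row-clique y a) λ {u} u∈M →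
    subst (_∈ Row y a) (sym (decidable-stable (u ≟ y) λ u≢y → ∄ (u , u∈M , u≢y))) centre∈Row)

-- The design cut out on an assembly

module Design {n} (Γ : FiniteGraph n) (dr : DistanceRegular Γ) {A r α b : ℕ}
  (local : ∀ x → LocalGrid Γ A r α x) (rows<cols : α * r < A * α)
  (valency≡ : DistanceRegular.valency dr ≡ r * (A * α))
  (c₂≡ : DistanceRegular.c dr 2 ≡ suc b * suc α)
  (b₂≡ : suc b ≤ r → suc b ≤ A → DistanceRegular.b dr 2 ≡ (A ∸ suc b) * ((r ∸ suc b) * α))
  (𝒞 : Pred (Subset n) 0ℓ) (geometric : Geometric Γ dr 𝒞)
  {M : Subset n} (assembly : Assembly Γ 𝒞 M) {x : Fin n} (distance : DistToSet Γ x M 2) where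

  open FiniteGraph Γ
  open LocallyGrid Γ local rows<cols
  open Neighbours Γ
  open Lines Γ dr local rows<cols valency≡ 𝒞 geometric
  module dr = DistanceRegular dr

  B : Subset n
  B = sphere Γ 2 x ∩ M

  M-clique : Clique Γ M
  M-clique = proj₁ (proj₁ assembly)

  ∈B⇒∈M : ∀ {y} → y ∈ B → y ∈ M
  ∈B⇒∈M y∈B = proj₂ (x∈p∩q⁻ (sphere Γ 2 x) M y∈B)

  ∈B⇒Dist : ∀ {y} → y ∈ B → Dist Γ x y 2
  ∈B⇒Dist y∈B = ∈-fromDec⁻ (λ y → dist? Γ x y 2) (proj₁ (x∈p∩q⁻ (sphere Γ 2 x) M y∈B))

  x∉M : x ∉ M
  x∉M x∈M = contradiction (proj₂ distance x 0 x∈M (refl , λ ())) λ ()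

  M-far : ∀ {y} → y ∈ M → ¬ x ~ y
  M-far {y} y∈M x~y = contradiction (proj₂ distance y 1 y∈M ((y , x~y , refl) , near)) λ { (s≤s ()) }
    where
    near : ∀ {j} → j < 1 → ¬ Walk Γ j x y
    near (s≤s z≤n) refl = irrefl x~y

  ∈B⁺ : ∀ {y} → y ∈ M → Walk Γ 2 x y → y ∈ B
  ∈B⁺ {y} y∈M walk = x∈p∩q⁺ (∈-fromDec⁺ (λ y → dist? Γ x y 2) (walk , near) , y∈M)
    where
    near : ∀ {j} → j < 2 → ¬ Walk Γ j x y
    near {zero}        _             refl           = x∉M y∈M
    near {suc zero}    _             (_ , x~y , refl) = M-far y∈M x~y
    near {suc (suc _)} (s≤s (s≤s ()))

  module At {y} (y∈B : y ∈ B) where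

    open SecondNeighbour {b} (∈B⇒Dist y∈B)
      (trans (dr.c-count 1 x y (∈B⇒Dist y∈B)) c₂≡)
      (λ b<r b<A → trans (dr.b-count 2 x y (∈B⇒Dist y∈B)) (b₂≡ b<r b<A)) public

    private
      y∈M = ∈B⇒∈M y∈B

      row : ∃[ a ] M ≡ Row y a
      row with ∈B⇒Dist y∈B
      -- The middle vertex of the walk from `x` to `y` is the neighbour of `y` that `assembly≡Row`
      -- asks for.
      ... | (_ , _ , _ , z~y , refl) , _ = assembly≡Row assembly y∈M (~-sym z~y)

    m : Fin A
    m = proj₁ row

    pt∈M : ∀ {j i} → pt y m j i ∈ M
    pt∈M {j} {i} = subst (pt y m j i ∈_) (sym (proj₂ row)) pt∈Row

    pt∈M⇒≡ : ∀ {a j i} → pt y a j i ∈ M → a ≡ m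
    pt∈M⇒≡ {a} {j} {i} pt∈ = pt∈Row⇒≡ (subst (pt y a j i ∈_) (proj₂ row) pt∈)

    -- A common neighbour of `x` and `y` in the row of `M` would be a point of `M` adjacent to `x`.
    m∉S : m ∉ S
    m∉S m∈S = let _ , _ , z∈μ = ∈S⁻ m∈S in M-far pt∈M (proj₁ (∈μ⁻ z∈μ))

    pt∈B : ∀ {j i} → j ∈ T → pt y m j i ∈ B
    pt∈B j∈T = ∈B⁺ pt∈M (∈T⇒Walk₂ m∉S j∈T)

    B-coords : ∀ {w} → w ∈ B → w ≢ y → ∃₂ λ j i → j ∈ T × pt y m j i ≡ w
    B-coords w∈B w≢y with loc (M-clique y∈M (∈B⇒∈M w∈B) (≢-sym w≢y))
    ... | a , j , i , refl with pt∈M⇒≡ (∈B⇒∈M w∈B)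
    ... | refl = j , i , Walk₂⇒∈T m∉S (proj₁ (∈B⇒Dist w∈B)) , refl

    ∣B∣ : ∣ B ∣ ≡ suc (suc b * α)
    ∣B∣ = trans (∣p∣≡suc-by B Fin.*↔× y (λ (t , i) → pt y m (e t) i)
      (λ eq → let _ , p , q = pt-inj eq in cong₂ _,_ (injective E p) q)
      (λ _ → pt≢) y∈B (λ (t , _) → pt∈B (sound E t)) cover) (cong (λ t → suc (t * α)) ∣T∣)
      where
      e = proj₁ (enumerate T)
      E = proj₂ (enumerate T)
      cover : ∀ {w} → w ∈ B → w ≡ y ⊎ ∃[ (t , i) ] pt y m (e t) i ≡ w
      cover {w} w∈B with w ≟ y
      ... | yes w≡y = inj₁ w≡y
      ... | no w≢y = let j , i , j∈T , eq = B-coords w∈B w≢y ; t , et≡j = complete E j∈T in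
        inj₂ ((t , i) , trans (cong (λ d → pt y m d i) et≡j) eq)

    -- At `y` the line is a column with index in `T`; it meets the row of `M` in one cell of α
    -- points, all in `B`, and `y` is one more.
    ∣line∩B∣ : ∀ {ℓ w} → 𝒞 ℓ → y ∈ ℓ → w ∈ ℓ → w ∈ B → w ≢ y → ∣ ℓ ∩ B ∣ ≡ suc α
    ∣line∩B∣ {ℓ} ℓ∈𝒞 y∈ℓ w∈ℓ w∈B w≢y with B-coords w∈B w≢y
    ... | j , i , j∈T , refl with line≡Col ℓ∈𝒞 y∈ℓ w∈ℓ
    ... | refl = ∣p∣≡suc-by (Col y j ∩ B) ↔-refl y (λ i → pt y m j i)
      (proj₂ ∘ proj₂ ∘ pt-inj) (λ _ → pt≢) (x∈p∩q⁺ (centre∈Col , y∈B))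
      (λ _ → x∈p∩q⁺ (pt∈Col , pt∈B j∈T)) cover
      where
      cover : ∀ {u} → u ∈ Col y j ∩ B → u ≡ y ⊎ ∃[ i ] pt y m j i ≡ u
      cover u∈ with x∈p∩q⁻ (Col y j) B u∈
      ... | u∈Col , u∈B with ∈Col⁻ u∈Col
      ... | inj₁ u≡y = inj₁ u≡y
      ... | inj₂ (a , i , refl) with pt∈M⇒≡ (∈B⇒∈M u∈B)
      ... | refl = inj₂ (i , refl)

  -- Two points of `B` are adjacent because `M` is a clique, so the geometric structure provides
  -- exactly one line through them, and its trace is the required block.
  design : IsDesign 2 (suc (suc b * α)) (suc α) 1 B (traces 𝒞 B)
  design = record { points = points ; blocks = blocks ; balance = balance }
    where
    points : ∣ B ∣ ≡ suc (suc b * α)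
    points = let (y , y∈M , walk , _) , _ = distance in At.∣B∣ (∈B⁺ y∈M walk)
    blocks : ∀ S → traces 𝒞 B S → S ⊆ B × ∣ S ∣ ≡ suc α
    blocks _ (ℓ , ℓ∈𝒞 , 2≤ , refl) with two-elements 2≤
    ... | y , w , y∈ , w∈ , y≢w with x∈p∩q⁻ ℓ B y∈ | x∈p∩q⁻ ℓ B w∈
    ... | y∈ℓ , y∈B | w∈ℓ , w∈B = p∩q⊆q ℓ B , At.∣line∩B∣ y∈B ℓ∈𝒞 y∈ℓ w∈ℓ w∈B (≢-sym y≢w)
    balance : ∀ P → P ⊆ B → ∣ P ∣ ≡ 2 → Exactly 1 (λ S → traces 𝒞 B S × P ⊆ S)
    balance P P⊆B ∣P∣≡2 with two-elements (ℕ.≤-reflexive (sym ∣P∣≡2))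
    ... | y , w , y∈P , w∈P , y≢w with proj₂ geometric y w (M-clique (∈B⇒∈M (P⊆B y∈P)) (∈B⇒∈M (P⊆B w∈P)) y≢w)
    ... | C , (C∈𝒞 , y∈C , w∈C) , C-unique =
      C ∩ B ∷ [] , (All.[] AllPairs.∷ AllPairs.[]) , refl , λ S → mk⇔ to from
      where
      P⊆C∩B : P ⊆ C ∩ B
      P⊆C∩B = subst (_⊆ C ∩ B) (⊆∧∣∣≤⇒≡ (⁅x⁆∪⁅y⁆⊆ y∈P w∈P)
          (ℕ.≤-reflexive (trans ∣P∣≡2 (sym (∣⁅x⁆∪⁅y⁆∣ y≢w)))))
        (⁅x⁆∪⁅y⁆⊆ (x∈p∩q⁺ (y∈C , P⊆B y∈P)) (x∈p∩q⁺ (w∈C , P⊆B w∈P)))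
      to : ∀ {S} → S ∈ˡ C ∩ B ∷ [] → traces 𝒞 B S × P ⊆ S
      to (here refl) = (C , C∈𝒞 , subst (_≤ ∣ C ∩ B ∣) ∣P∣≡2 (p⊆q⇒∣p∣≤∣q∣ P⊆C∩B) , refl) , P⊆C∩B
      from : ∀ {S} → traces 𝒞 B S × P ⊆ S → S ∈ˡ C ∩ B ∷ []
      from ((ℓ , ℓ∈𝒞 , _ , refl) , P⊆ℓ∩B) = here (cong (_∩ B) (sym (C-unique
        (ℓ∈𝒞 , proj₁ (x∈p∩q⁻ ℓ B (P⊆ℓ∩B y∈P)) , proj₁ (x∈p∩q⁻ ℓ B (P⊆ℓ∩B w∈P))))))

-- By `design-∣`, after cancelling α, the number α + 1 divides (1 + (b + 1)α)(b + 1). Modulo α + 1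
-- one has α ≡ -1, so this product is -b(b + 1).
design-∣-b[b+1] : ∀ {n α b} .{{_ : ℕ.NonZero α}} {B : Subset n} {ℬ : Pred (Subset n) 0ℓ} →
  IsDesign 2 (suc (suc b * α)) (suc α) 1 B ℬ → suc α ∣ b * (b + 1)
design-∣-b[b+1] {α = α} {b} design = ∣m+n∣m⇒∣n
  (divides (suc b * suc b) (identity b α))
  (*-cancelʳ-∣ α (subst (suc α * α ∣_) (sym (ℕ.*-assoc (suc (suc b * α)) (suc b) α)) (design-∣ design)))
  where
  identity : ∀ b α → suc (suc b * α) * suc b + b * (b + 1) ≡ suc b * suc b * suc α
  identity = solve 2 (λ b α → (con 1 :+ (con 1 :+ b) :* α) :* (con 1 :+ b) :+ b :* (b :+ con 1)
    := (con 1 :+ b) :* (con 1 :+ b) :* (con 1 :+ α)) refl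
    where open +-*-Solver

theorem28 : ∀ {n : ℕ} (Γ : FiniteGraph n) (dr : DistanceRegular Γ)
    (D b α β : ℕ) .{{_ : ℤ.NonZero (+ b ℤ.- 1ℤ)}} →
    ClassicalParameters dr D (+ b) (fromℕ α) (fromℕ β) →
    2 ≤ b → 1 ≤ α → α ≤ b ∸ 1 → 3 ≤ D →
    (𝒞 : Pred (Subset n) 0ℓ) → Geometric Γ dr 𝒞 →
    (r : ℕ) → + r ≡ bracket (+ b) D →
    (β/α : ℕ) → β/α * α ≡ β →
    (∀ x → localGraph Γ x ≅ cliqueExtension α (grid β/α r)) →
    α * r < β →
    (M : Subset n) → Assembly Γ 𝒞 M →
    (x : Fin n) → DistToSet Γ x M 2 →
    let B = sphere Γ 2 x ∩ M in
    IsDesign 2 (α * (b + 1) + 1) (α + 1) 1 B (traces 𝒞 B)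
    × (α + 1) ∣ (b * (b + 1))
-- Matching `refl` replaces β by `A * α`. The pattern for `b` exposes `b′` = b - 2 for `Parameters`,
-- and the one for `α` makes it visibly nonzero for the cancellation.
theorem28 Γ dr D b@(suc (suc b′)) α@(suc _) _ params (s≤s (s≤s _)) _ _ 3≤D 𝒞 geometric
  r r≡[D] A refl local αr<β M assembly x distance =
  subst₂ (λ v k → IsDesign 2 v k 1 (sphere Γ 2 x ∩ M) (traces 𝒞 (sphere Γ 2 x ∩ M))) v≡ k≡ design ,
  subst (_∣ b * (b + 1)) k≡ (design-∣-b[b+1] design)
  where
  open Parameters dr {b = b′} {α = α} {β = A * α} params r≡[D]
  2≤D = ℕ.≤-trans (ℕ.n≤1+n 2) 3≤D
  open Design Γ dr {b = b} (λ x → local-grid Γ x (local x)) αr<β valency≡ (c₂≡ 2≤D) (b₂≡ {A} refl 2≤D)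
    𝒞 geometric assembly distance
  v≡ : suc (suc b * α) ≡ α * (b + 1) + 1
  v≡ = trans (ℕ.+-comm 1 (suc b * α)) (cong (_+ 1) (trans (ℕ.*-comm (suc b) α) (cong (α *_) (ℕ.+-comm 1 b))))
  k≡ : suc α ≡ α + 1
  k≡ = ℕ.+-comm 1 α
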